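{- Let $\mathbb{A}$ be a symmetric strict monoidal category and let $\mathbf{H}\,\mathcal{C}(\mathbb{A})$ be the strict monoidal category of horizontal cells of its free cornering. There are strong monoidal functors $(-)^\circ:\mathbb{A}\to\mathbf{H}\,\mathcal{C}(\mathbb{A})$ and $(-)^\bullet:\mathbb{A}^{\mathsf{op}}\to\mathbf{H}\,\mathcal{C}(\mathbb{A})$, sending an object $A$ to $A^\circ$ and $A^\bullet$ respectively, and defined on $f:A\to B$ of $\mathbb{A}$ as follows: $f^\circ:A^\circ\to B^\circ$ is the vertical composite, from top to bottom, of $r^\circ_A$, $\ulcorner f\urcorner$, $s^\circ_B$; and $f^\bullet:B^\bullet\to A^\bullet$ is the vertical composite, from top to bottom, of $r^\bullet_A$, $\ulcorner f\urcorner$, $s^\bullet_B$. Further, each of these functors is full and faithful.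
   Context: Single-object double categories. A single-object double category $\mathbb{D}$ consists of a monoid $(\mathbb{D}_H,\otimes,I)$ of horizontal edges, a monoid $(\mathbb{D}_V,\otimes,I)$ of vertical edges, and cells $\alpha$, each with a top and a bottom boundary in $\mathbb{D}_H$ and a left and a right boundary in $\mathbb{D}_V$. If the right boundary of $\alpha$ equals the left boundary of $\beta$ there is a horizontal composite $\alpha\vert\beta$ (top/bottom boundaries are multiplied in the order $\alpha,\beta$; left boundary that of $\alpha$, right boundary that of $\beta$). If the bottom boundary of $\alpha$ equals the top boundary of $\beta$ there is a vertical composite $\frac{\alpha}{\beta}$ (left/right boundaries multiplied in the order $\alpha,\beta$; top that of $\alpha$, bottom that of $\beta$). Both compositions are associative and unital, with identity cells $1_A$ for $A\in\mathbb{D}_H$ (top $=$ bottom $=A$, left $=$ right $=I$; identities for vertical composition) and $1_X$ for $X\in\mathbb{D}_V$ (left $=$ right $=X$, top $=$ bottom $=I$; identities for horizontal composition), with $1_A\vert 1_B=1_{A\otimes B}$, $\frac{1_X}{1_Y}=1_{X\otimes Y}$, the two identity cells on $I$ coincide, and the interchange law $\frac{\alpha}{\beta}\big\vert\frac{\gamma}{\delta}=\frac{\alpha\vert\gamma}{\beta\vert\delta}$ holds. Horizontal cells. $\mathbf{H}\mathbb{D}$ is the strict monoidal category with object set $\mathbb{D}_V$, whose morphisms $X\to Y$ are cells with left boundary $X$, right boundary $Y$ and top and bottom boundary $I$; composition is horizontal composition, and the tensor product is vertical composition, $h\otimes k=\frac{h}{k}$. Free cornering. For a symmetric strict monoidal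 category $\mathbb{A}$ (with object set $\mathbb{A}_0$), $\mathcal{C}(\mathbb{A})$ is the free single-object double category determined by: horizontal edge monoid $(\mathbb{A}_0,\otimes,I)$; vertical edge monoid the free monoid $\mathbb{A}^{\circ\bullet}=(\mathbb{A}_0\times\{\circ,\bullet\})^*$, with generators written $A^\circ$, $A^\bullet$, product written $\otimes$ and unit $I$; generating cells, for each $A\in\mathbb{A}_0$, the corners (boundaries not mentioned are $I$) - $s^\circ_A$: top $A$, right $A^\circ$; $\quad r^\circ_A$: left $A^\circ$, bottom $A$; - $s^\bullet_A$: top $A$, left $A^\bullet$; $\quad r^\bullet_A$: right $A^\bullet$, bottom $A$; and, for each morphism $f:A\to B$ of $\mathbb{A}$, a cell $\ulcorner f\urcorner$ with top $A$, bottom $B$; subject to the yanking equations $s^\circ_A\vert r^\circ_A=1_A$, $\frac{r^\circ_A}{s^\circ_A}=1_{A^\circ}$, $r^\bullet_A\vert s^\bullet_A=1_A$, $\frac{r^\bullet_A}{s^\bullet_A}=1_{A^\bullet}$, and the equations $\frac{\ulcorner f\urcorner}{\ulcorner g\urcorner}=\ulcorner f;g\urcorner$ (for composable $f,g$; $f;g$ is "first $f$ then $g$"), $\ulcorner 1_A\urcorner=1_A$, $\ulcorner f\urcorner\vert\ulcorner g\urcorner=\ulcorner f\otimes g\urcorner$. $\mathbb{A}^{\mathsf{op}}$ carries the tensor product of $\mathbb{A}$ (same order of factors). -}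

module Defs where

open import Level using (Level; _⊔_) renaming (suc to lsuc)
open import Algebra.Structures using (IsMonoid)
open import Data.List.Base using (List; []; _∷_; _++_)
open import Data.List.Properties using (++-isMonoid)
open import Data.Product.Base using (_×_; _,_)
open import Function.Definitions using (Injective; StrictlySurjective)
open import Relation.Binary.Structures using (IsEquivalence)
open import Relation.Binary.PropositionalEquality using (_≡_; refl; sym; subst₂)

-- Objects and edges are compared by propositional equality (axiom K is on, so
-- that they form sets); morphisms and cells are compared by an explicit
-- equivalence relation _≈_, which stands for equality. An equation whose two
-- sides have boundaries that agree only up to _≡_ is stated by transporting the
-- left-hand side with subst₂.

record StrictMonoidalCategory (o ℓ e : Level) : Set (lsuc (o ⊔ ℓ ⊔ e)) where
  infix  4 _≈_
  infixr 7 _⨟_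
  infixr 8 _⊗₀_ _⊗₁_
  field
    Obj        : Set o
    _⊗₀_       : Obj → Obj → Obj
    I          : Obj
    ⊗-isMonoid : IsMonoid _≡_ _⊗₀_ I

    Hom           : Obj → Obj → Set ℓ
    _≈_           : ∀ {A B} → Hom A B → Hom A B → Set e
    ≈-isEquivalence : ∀ {A B} → IsEquivalence (_≈_ {A} {B})

    -- Composition is in diagrammatic order.
    id        : ∀ A → Hom A A
    _⨟_       : ∀ {A B C} → Hom A B → Hom B C → Hom A C
    ⨟-cong    : ∀ {A B C} {f f′ : Hom A B} {g g′ : Hom B C} →
                f ≈ f′ → g ≈ g′ → f ⨟ g ≈ f′ ⨟ g′
    ⨟-assoc   : ∀ {A B C D} (f : Hom A B) (g : Hom B C) (h : Hom C D) →
                (f ⨟ g) ⨟ h ≈ f ⨟ (g ⨟ h)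
    ⨟-identityˡ : ∀ {A B} (f : Hom A B) → id A ⨟ f ≈ f
    ⨟-identityʳ : ∀ {A B} (f : Hom A B) → f ⨟ id B ≈ f

    _⊗₁_   : ∀ {A B C D} → Hom A B → Hom C D → Hom (A ⊗₀ C) (B ⊗₀ D)
    ⊗₁-cong : ∀ {A B C D} {f f′ : Hom A B} {g g′ : Hom C D} →
              f ≈ f′ → g ≈ g′ → f ⊗₁ g ≈ f′ ⊗₁ g′
    ⊗₁-id   : ∀ A B → id A ⊗₁ id B ≈ id (A ⊗₀ B)
    ⊗₁-⨟    : ∀ {A B C A′ B′ C′} (f : Hom A B) (g : Hom B C)
              (f′ : Hom A′ B′) (g′ : Hom B′ C′) →
              (f ⨟ g) ⊗₁ (f′ ⨟ g′) ≈ (f ⊗₁ f′) ⨟ (g ⊗₁ g′)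

  open IsMonoid ⊗-isMonoid public using ()
    renaming (assoc to ⊗₀-assoc; identityˡ to ⊗₀-identityˡ; identityʳ to ⊗₀-identityʳ)

  field
    ⊗₁-assoc     : ∀ {A B C D E F} (f : Hom A B) (g : Hom C D) (h : Hom E F) →
                   subst₂ Hom (⊗₀-assoc A C E) (⊗₀-assoc B D F) ((f ⊗₁ g) ⊗₁ h)
                     ≈ f ⊗₁ (g ⊗₁ h)
    ⊗₁-identityˡ : ∀ {A B} (f : Hom A B) →
                   subst₂ Hom (⊗₀-identityˡ A) (⊗₀-identityˡ B) (id I ⊗₁ f) ≈ f
    ⊗₁-identityʳ : ∀ {A B} (f : Hom A B) →
                   subst₂ Hom (⊗₀-identityʳ A) (⊗₀-identityʳ B) (f ⊗₁ id I) ≈ f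

  eqToHom : ∀ {A B} → A ≡ B → Hom A B
  eqToHom {A} refl = id A

  -- The associator and unitors are identities, up to the object equations.
  associator : ∀ A B C → Hom ((A ⊗₀ B) ⊗₀ C) (A ⊗₀ (B ⊗₀ C))
  associator A B C = eqToHom (⊗₀-assoc A B C)

  unitorˡ : ∀ A → Hom (I ⊗₀ A) A
  unitorˡ A = eqToHom (⊗₀-identityˡ A)

  unitorʳ : ∀ A → Hom (A ⊗₀ I) A
  unitorʳ A = eqToHom (⊗₀-identityʳ A)

  record Iso (A B : Obj) : Set (ℓ ⊔ e) where
    field
      to      : Hom A B
      from    : Hom B A
      to-from : to ⨟ from ≈ id A
      from-to : from ⨟ to ≈ id B

record SymmetricStrictMonoidalCategory (o ℓ e : Level) : Set (lsuc (o ⊔ ℓ ⊔ e)) where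
  field
    strictMonoidal : StrictMonoidalCategory o ℓ e
  open StrictMonoidalCategory strictMonoidal public
  field
    σ            : ∀ A B → Hom (A ⊗₀ B) (B ⊗₀ A)
    σ-natural    : ∀ {A B C D} (f : Hom A B) (g : Hom C D) →
                   (f ⊗₁ g) ⨟ σ B D ≈ σ A C ⨟ (g ⊗₁ f)
    σ-involutive : ∀ A B → σ A B ⨟ σ B A ≈ id (A ⊗₀ B)
    σ-hexagon    : ∀ A B C →
                   associator A B C ⨟ σ A (B ⊗₀ C) ⨟ associator B C A
                     ≈ (σ A B ⊗₁ id C) ⨟ associator B A C ⨟ (id B ⊗₁ σ A C)

private
  subst₂-flip : ∀ {o ℓ} {O : Set o} (P : O → O → Set ℓ) {A A′ B B′ : O}
                (p : A ≡ A′) (q : B ≡ B′) (x : P A B) →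
                subst₂ (λ X Y → P Y X) q p x ≡ subst₂ P p q x
  subst₂-flip P refl refl x = refl

op : ∀ {o ℓ e} → StrictMonoidalCategory o ℓ e → StrictMonoidalCategory o ℓ e
op 𝔸 = record
  { Obj = Obj ; _⊗₀_ = _⊗₀_ ; I = I ; ⊗-isMonoid = ⊗-isMonoid
  ; Hom = λ A B → Hom B A
  ; _≈_ = _≈_
  ; ≈-isEquivalence = ≈-isEquivalence
  ; id = id
  ; _⨟_ = λ f g → g ⨟ f
  ; ⨟-cong = λ p q → ⨟-cong q p
  ; ⨟-assoc = λ f g h → ≈.sym (⨟-assoc h g f)
  ; ⨟-identityˡ = ⨟-identityʳ
  ; ⨟-identityʳ = ⨟-identityˡ
  ; _⊗₁_ = _⊗₁_
  ; ⊗₁-cong = ⊗₁-cong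
  ; ⊗₁-id = ⊗₁-id
  ; ⊗₁-⨟ = λ f g f′ g′ → ⊗₁-⨟ g f g′ f′
  ; ⊗₁-assoc = λ f g h →
      ≈.trans (≈.reflexive (subst₂-flip Hom (⊗₀-assoc _ _ _) (⊗₀-assoc _ _ _) _)) (⊗₁-assoc f g h)
  ; ⊗₁-identityˡ = λ f →
      ≈.trans (≈.reflexive (subst₂-flip Hom (⊗₀-identityˡ _) (⊗₀-identityˡ _) _)) (⊗₁-identityˡ f)
  ; ⊗₁-identityʳ = λ f →
      ≈.trans (≈.reflexive (subst₂-flip Hom (⊗₀-identityʳ _) (⊗₀-identityʳ _) _)) (⊗₁-identityʳ f)
  }
  where
  open StrictMonoidalCategory 𝔸
  module ≈ {A B} = IsEquivalence (≈-isEquivalence {A} {B})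

module _ {o ℓ e o′ ℓ′ e′}
  (𝔸 : StrictMonoidalCategory o ℓ e) (𝔹 : StrictMonoidalCategory o′ ℓ′ e′)
  (F₀ : StrictMonoidalCategory.Obj 𝔸 → StrictMonoidalCategory.Obj 𝔹)
  (F₁ : ∀ {A B} → StrictMonoidalCategory.Hom 𝔸 A B →
        StrictMonoidalCategory.Hom 𝔹 (F₀ A) (F₀ B))
  where

  private
    module A = StrictMonoidalCategory 𝔸
    module B = StrictMonoidalCategory 𝔹
  open A using () renaming (_⊗₀_ to _⊗ᴬ_)
  open B using (_⨟_; _⊗₁_; _≈_) renaming (_⊗₀_ to _⊗ᴮ_)

  -- Functoriality of (F₀ , F₁) together with a strong monoidal structure.
  record IsStrongMonoidalFunctor : Set (o ⊔ ℓ ⊔ e ⊔ ℓ′ ⊔ e′) where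
    field
      F-cong : ∀ {A B} {f g : A.Hom A B} → f A.≈ g → F₁ f ≈ F₁ g
      F-id   : ∀ A → F₁ (A.id A) ≈ B.id (F₀ A)
      F-⨟    : ∀ {A B C} (f : A.Hom A B) (g : A.Hom B C) →
               F₁ (f A.⨟ g) ≈ F₁ f ⨟ F₁ g

      ε-iso : B.Iso B.I (F₀ A.I)
      μ-iso : ∀ A B → B.Iso (F₀ A ⊗ᴮ F₀ B) (F₀ (A ⊗ᴬ B))

    ε : B.Hom B.I (F₀ A.I)
    ε = B.Iso.to ε-iso

    μ : ∀ A B → B.Hom (F₀ A ⊗ᴮ F₀ B) (F₀ (A ⊗ᴬ B))
    μ A B = B.Iso.to (μ-iso A B)

    field
      μ-natural : ∀ {A B C D} (f : A.Hom A B) (g : A.Hom C D) →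
                  (F₁ f ⊗₁ F₁ g) ⨟ μ B D ≈ μ A C ⨟ F₁ (f A.⊗₁ g)
      μ-associative : ∀ A B C →
                  (μ A B ⊗₁ B.id (F₀ C)) ⨟ μ (A ⊗ᴬ B) C ⨟ F₁ (A.associator A B C)
                    ≈ B.associator (F₀ A) (F₀ B) (F₀ C)
                        ⨟ (B.id (F₀ A) ⊗₁ μ B C) ⨟ μ A (B ⊗ᴬ C)
      μ-unitalˡ : ∀ A → (ε ⊗₁ B.id (F₀ A)) ⨟ μ A.I A ⨟ F₁ (A.unitorˡ A)
                          ≈ B.unitorˡ (F₀ A)
      μ-unitalʳ : ∀ A → (B.id (F₀ A) ⊗₁ ε) ⨟ μ A A.I ⨟ F₁ (A.unitorʳ A)
                          ≈ B.unitorʳ (F₀ A)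

  Full : Set (o ⊔ ℓ ⊔ ℓ′ ⊔ e′)
  Full = ∀ {A B} → StrictlySurjective (_≈_ {F₀ A} {F₀ B}) (F₁ {A} {B})

  Faithful : Set (o ⊔ ℓ ⊔ e ⊔ e′)
  Faithful = ∀ {A B} → Injective (A._≈_ {A} {B}) (_≈_ {F₀ A} {F₀ B}) F₁

record SingleObjectDoubleCategory (h v c e : Level) : Set (lsuc (h ⊔ v ⊔ c ⊔ e)) where
  infix  4 _≈_
  infixr 7 _∣_
  infixr 8 _⊘_
  infixr 9 _⊗ʰ_ _⊗ᵛ_
  field
    HEdge     : Set h
    _⊗ʰ_      : HEdge → HEdge → HEdge
    Iʰ        : HEdge
    isMonoidʰ : IsMonoid _≡_ _⊗ʰ_ Iʰ

    VEdge     : Set v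
    _⊗ᵛ_      : VEdge → VEdge → VEdge
    Iᵛ        : VEdge
    isMonoidᵛ : IsMonoid _≡_ _⊗ᵛ_ Iᵛ

    -- Cell top bottom left right
    Cell : HEdge → HEdge → VEdge → VEdge → Set c
    _≈_  : ∀ {A B X Y} → Cell A B X Y → Cell A B X Y → Set e
    ≈-isEquivalence : ∀ {A B X Y} → IsEquivalence (_≈_ {A} {B} {X} {Y})

    _∣_ : ∀ {A B C D X Y Z} → Cell A B X Y → Cell C D Y Z → Cell (A ⊗ʰ C) (B ⊗ʰ D) X Z
    -- α ⊘ β is the vertical composite with α on top of β.
    _⊘_ : ∀ {A B C X Y X′ Y′} → Cell A B X Y → Cell B C X′ Y′ →
          Cell A C (X ⊗ᵛ X′) (Y ⊗ᵛ Y′)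
    idʰ : ∀ A → Cell A A Iᵛ Iᵛ
    idᵛ : ∀ X → Cell Iʰ Iʰ X X

    ∣-cong : ∀ {A B C D X Y Z} {α α′ : Cell A B X Y} {β β′ : Cell C D Y Z} →
             α ≈ α′ → β ≈ β′ → α ∣ β ≈ α′ ∣ β′
    ⊘-cong : ∀ {A B C X Y X′ Y′} {α α′ : Cell A B X Y} {β β′ : Cell B C X′ Y′} →
             α ≈ α′ → β ≈ β′ → α ⊘ β ≈ α′ ⊘ β′

  open IsMonoid isMonoidʰ public using ()
    renaming (assoc to ⊗ʰ-assoc; identityˡ to ⊗ʰ-identityˡ; identityʳ to ⊗ʰ-identityʳ)
  open IsMonoid isMonoidᵛ public using ()
    renaming (assoc to ⊗ᵛ-assoc; identityˡ to ⊗ᵛ-identityˡ; identityʳ to ⊗ᵛ-identityʳ)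

  field
    ∣-assoc : ∀ {A B C D E F X Y Z W}
              (α : Cell A B X Y) (β : Cell C D Y Z) (γ : Cell E F Z W) →
              subst₂ (λ T U → Cell T U X W) (⊗ʰ-assoc A C E) (⊗ʰ-assoc B D F) ((α ∣ β) ∣ γ)
                ≈ α ∣ (β ∣ γ)
    ∣-identityˡ : ∀ {A B X Y} (α : Cell A B X Y) →
              subst₂ (λ T U → Cell T U X Y) (⊗ʰ-identityˡ A) (⊗ʰ-identityˡ B) (idᵛ X ∣ α) ≈ α
    ∣-identityʳ : ∀ {A B X Y} (α : Cell A B X Y) →
              subst₂ (λ T U → Cell T U X Y) (⊗ʰ-identityʳ A) (⊗ʰ-identityʳ B) (α ∣ idᵛ Y) ≈ α

    ⊘-assoc : ∀ {A B C D X Y X′ Y′ X″ Y″}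
              (α : Cell A B X Y) (β : Cell B C X′ Y′) (γ : Cell C D X″ Y″) →
              subst₂ (Cell A D) (⊗ᵛ-assoc X X′ X″) (⊗ᵛ-assoc Y Y′ Y″) ((α ⊘ β) ⊘ γ)
                ≈ α ⊘ (β ⊘ γ)
    ⊘-identityˡ : ∀ {A B X Y} (α : Cell A B X Y) →
              subst₂ (Cell A B) (⊗ᵛ-identityˡ X) (⊗ᵛ-identityˡ Y) (idʰ A ⊘ α) ≈ α
    ⊘-identityʳ : ∀ {A B X Y} (α : Cell A B X Y) →
              subst₂ (Cell A B) (⊗ᵛ-identityʳ X) (⊗ᵛ-identityʳ Y) (α ⊘ idʰ B) ≈ α

    idʰ-⊗ : ∀ A B → idʰ A ∣ idʰ B ≈ idʰ (A ⊗ʰ B)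
    idᵛ-⊗ : ∀ X Y → idᵛ X ⊘ idᵛ Y ≈ idᵛ (X ⊗ᵛ Y)
    idʰ-I : idʰ Iʰ ≈ idᵛ Iᵛ

    interchange : ∀ {A B C D E F X Y Z X′ Y′ Z′}
              (α : Cell A B X Y) (β : Cell B C X′ Y′)
              (γ : Cell D E Y Z) (δ : Cell E F Y′ Z′) →
              (α ⊘ β) ∣ (γ ⊘ δ) ≈ (α ∣ γ) ⊘ (β ∣ δ)

module HorizontalCells {h v c e} (𝔻 : SingleObjectDoubleCategory h v c e) where
  open SingleObjectDoubleCategory 𝔻

  HCell : VEdge → VEdge → Set c
  HCell X Y = Cell Iʰ Iʰ X Y

  -- The composite f ∣ g has top and bottom Iʰ ⊗ʰ Iʰ, which equals Iʰ.
  infixr 7 _⨟_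
  _⨟_ : ∀ {X Y Z} → HCell X Y → HCell Y Z → HCell X Z
  _⨟_ {X} {Y} {Z} f g =
    subst₂ (λ T U → Cell T U X Z) (⊗ʰ-identityˡ Iʰ) (⊗ʰ-identityˡ Iʰ) (f ∣ g)

  module ≈ {A B X Y} = IsEquivalence (≈-isEquivalence {A} {B} {X} {Y})

  -- Equality of cells whose boundaries need only agree up to _≡_.
  infix 4 _≋_
  data _≋_ {A B X Y} (α : Cell A B X Y) :
           ∀ {A′ B′ X′ Y′} → Cell A′ B′ X′ Y′ → Set (h ⊔ v ⊔ c ⊔ e) where
    same : ∀ {β : Cell A B X Y} → α ≈ β → α ≋ β

  from≋ : ∀ {A B X Y} {α β : Cell A B X Y} → α ≋ β → α ≈ β
  from≋ (same p) = p

  ≋-sym : ∀ {A B X Y A′ B′ X′ Y′} {α : Cell A B X Y} {β : Cell A′ B′ X′ Y′} →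
          α ≋ β → β ≋ α
  ≋-sym (same p) = same (≈.sym p)

  infixr 5 _∙_
  _∙_ : ∀ {A B X Y A′ B′ X′ Y′ A″ B″ X″ Y″} {α : Cell A B X Y}
        {β : Cell A′ B′ X′ Y′} {γ : Cell A″ B″ X″ Y″} → α ≋ β → β ≋ γ → α ≋ γ
  same p ∙ same q = same (≈.trans p q)

  ∣-≋ : ∀ {A B C D X Y Z A′ B′ C′ D′ X′ Y′ Z′}
        {α : Cell A B X Y} {β : Cell C D Y Z} {α′ : Cell A′ B′ X′ Y′} {β′ : Cell C′ D′ Y′ Z′} →
        α ≋ α′ → β ≋ β′ → α ∣ β ≋ α′ ∣ β′
  ∣-≋ (same p) (same q) = same (∣-cong p q)

  ⊘-≋ : ∀ {A B C X Y Z W A′ B′ C′ X′ Y′ Z′ W′}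
        {α : Cell A B X Y} {β : Cell B C Z W} {α′ : Cell A′ B′ X′ Y′} {β′ : Cell B′ C′ Z′ W′} →
        α ≋ α′ → β ≋ β′ → α ⊘ β ≋ α′ ⊘ β′
  ⊘-≋ (same p) (same q) = same (⊘-cong p q)

  transport : ∀ {A A′ B B′ X Y} (p : A ≡ A′) (q : B ≡ B′) (α : Cell A B X Y) →
              α ≋ subst₂ (λ T U → Cell T U X Y) p q α
  transport refl refl α = same ≈.refl

  ⨟-≋ : ∀ {X Y Z} (f : HCell X Y) (g : HCell Y Z) → f ⨟ g ≋ f ∣ g
  ⨟-≋ f g = ≋-sym (transport _ _ (f ∣ g))

  ⨟-cong : ∀ {X Y Z} {f f′ : HCell X Y} {g g′ : HCell Y Z} →
           f ≈ f′ → g ≈ g′ → f ⨟ g ≈ f′ ⨟ g′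
  ⨟-cong {f = f} {f′} {g} {g′} p q =
    from≋ (⨟-≋ f g ∙ same (∣-cong p q) ∙ ≋-sym (⨟-≋ f′ g′))

  ⨟-assoc : ∀ {X Y Z W} (f : HCell X Y) (g : HCell Y Z) (k : HCell Z W) →
            (f ⨟ g) ⨟ k ≈ f ⨟ (g ⨟ k)
  ⨟-assoc f g k = from≋
    (⨟-≋ (f ⨟ g) k ∙ ∣-≋ (⨟-≋ f g) (same ≈.refl) ∙ transport _ _ ((f ∣ g) ∣ k)
      ∙ same (∣-assoc f g k)
      ∙ ∣-≋ (same ≈.refl) (≋-sym (⨟-≋ g k)) ∙ ≋-sym (⨟-≋ f (g ⨟ k)))

  ⨟-identityˡ : ∀ {X Y} (f : HCell X Y) → idᵛ X ⨟ f ≈ f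
  ⨟-identityˡ f = from≋ (⨟-≋ _ f ∙ transport _ _ _ ∙ same (∣-identityˡ f))

  ⨟-identityʳ : ∀ {X Y} (f : HCell X Y) → f ⨟ idᵛ Y ≈ f
  ⨟-identityʳ f = from≋ (⨟-≋ f _ ∙ transport _ _ _ ∙ same (∣-identityʳ f))

  ⊗-⨟ : ∀ {X Y Z X′ Y′ Z′} (f : HCell X Y) (g : HCell Y Z)
        (f′ : HCell X′ Y′) (g′ : HCell Y′ Z′) →
        (f ⨟ g) ⊘ (f′ ⨟ g′) ≈ (f ⊘ f′) ⨟ (g ⊘ g′)
  ⊗-⨟ f g f′ g′ = from≋
    (⊘-≋ (⨟-≋ f g) (⨟-≋ f′ g′) ∙ same (≈.sym (interchange f f′ g g′))
      ∙ ≋-sym (⨟-≋ (f ⊘ f′) (g ⊘ g′)))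

  subst₂-cong : ∀ {X X′ Y Y′} (p : X ≡ X′) (q : Y ≡ Y′) {f g : HCell X Y} →
                f ≈ g → subst₂ HCell p q f ≈ subst₂ HCell p q g
  subst₂-cong refl refl r = r

  ⊘-identityˡ′ : ∀ {X Y} (f : HCell X Y) →
    subst₂ HCell (⊗ᵛ-identityˡ X) (⊗ᵛ-identityˡ Y) (idᵛ Iᵛ ⊘ f) ≈ f
  ⊘-identityˡ′ f = ≈.trans
    (subst₂-cong _ _ (⊘-cong (≈.sym idʰ-I) ≈.refl)) (⊘-identityˡ f)

  ⊘-identityʳ′ : ∀ {X Y} (f : HCell X Y) →
    subst₂ HCell (⊗ᵛ-identityʳ X) (⊗ᵛ-identityʳ Y) (f ⊘ idᵛ Iᵛ) ≈ f
  ⊘-identityʳ′ f = ≈.trans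
    (subst₂-cong _ _ (⊘-cong ≈.refl (≈.sym idʰ-I))) (⊘-identityʳ f)

  𝐇 : StrictMonoidalCategory v c e
  𝐇 = record
    { Obj = VEdge ; _⊗₀_ = _⊗ᵛ_ ; I = Iᵛ ; ⊗-isMonoid = isMonoidᵛ
    ; Hom = HCell
    ; _≈_ = _≈_
    ; ≈-isEquivalence = ≈-isEquivalence
    ; id = idᵛ
    ; _⨟_ = _⨟_
    ; ⨟-cong = ⨟-cong
    ; ⨟-assoc = ⨟-assoc
    ; ⨟-identityˡ = ⨟-identityˡ
    ; ⨟-identityʳ = ⨟-identityʳ
    ; _⊗₁_ = _⊘_
    ; ⊗₁-cong = ⊘-cong
    ; ⊗₁-id = idᵛ-⊗
    ; ⊗₁-⨟ = ⊗-⨟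
    ; ⊗₁-assoc = ⊘-assoc
    ; ⊗₁-identityˡ = ⊘-identityˡ′
    ; ⊗₁-identityʳ = ⊘-identityʳ′
    }

open HorizontalCells public using (𝐇)

data Polarity : Set where
  ○ ● : Polarity

module FreeCornering {o ℓ e} (𝔸 : SymmetricStrictMonoidalCategory o ℓ e) where
  private module 𝔸 = SymmetricStrictMonoidalCategory 𝔸
  open 𝔸 using (Obj; Hom; I) renaming (_⊗₀_ to _⊗_)

  Exchange : Set o
  Exchange = List (Obj × Polarity)

  infix 10 _° _•
  _° _• : Obj → Exchange
  A ° = (A , ○) ∷ []
  A • = (A , ●) ∷ []

  private module ++ = IsMonoid (++-isMonoid {A = Obj × Polarity})

  -- The free double category is the term model: cells are formal composites of
  -- generators, identified by the least congruence containing the equations.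
  -- As above, the indices are: top, bottom, left, right.
  infixr 7 _∣_
  infixr 8 _⊘_
  data Cell : Obj → Obj → Exchange → Exchange → Set (o ⊔ ℓ) where
    s° : ∀ A → Cell A I [] (A °)
    r° : ∀ A → Cell I A (A °) []
    s• : ∀ A → Cell A I (A •) []
    r• : ∀ A → Cell I A [] (A •)
    ⌜_⌝ : ∀ {A B} → Hom A B → Cell A B [] []
    idʰ : ∀ A → Cell A A [] []
    idᵛ : ∀ X → Cell I I X X
    _∣_ : ∀ {A B C D X Y Z} → Cell A B X Y → Cell C D Y Z → Cell (A ⊗ C) (B ⊗ D) X Z
    _⊘_ : ∀ {A B C X Y X′ Y′} → Cell A B X Y → Cell B C X′ Y′ →
          Cell A C (X ++ X′) (Y ++ Y′)

  infix 4 _≈_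
  data _≈_ : ∀ {A B X Y} → Cell A B X Y → Cell A B X Y → Set (o ⊔ ℓ ⊔ e) where
    ≈-refl  : ∀ {A B X Y} {α : Cell A B X Y} → α ≈ α
    ≈-sym   : ∀ {A B X Y} {α β : Cell A B X Y} → α ≈ β → β ≈ α
    ≈-trans : ∀ {A B X Y} {α β γ : Cell A B X Y} → α ≈ β → β ≈ γ → α ≈ γ
    ∣-cong  : ∀ {A B C D X Y Z} {α α′ : Cell A B X Y} {β β′ : Cell C D Y Z} →
              α ≈ α′ → β ≈ β′ → α ∣ β ≈ α′ ∣ β′
    ⊘-cong  : ∀ {A B C X Y X′ Y′} {α α′ : Cell A B X Y} {β β′ : Cell B C X′ Y′} →
              α ≈ α′ → β ≈ β′ → α ⊘ β ≈ α′ ⊘ β′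

    ∣-assoc : ∀ {A B C D E F X Y Z W}
              (α : Cell A B X Y) (β : Cell C D Y Z) (γ : Cell E F Z W) →
              subst₂ (λ T U → Cell T U X W) (𝔸.⊗₀-assoc A C E) (𝔸.⊗₀-assoc B D F)
                ((α ∣ β) ∣ γ) ≈ α ∣ (β ∣ γ)
    ∣-identityˡ : ∀ {A B X Y} (α : Cell A B X Y) →
              subst₂ (λ T U → Cell T U X Y) (𝔸.⊗₀-identityˡ A) (𝔸.⊗₀-identityˡ B)
                (idᵛ X ∣ α) ≈ α
    ∣-identityʳ : ∀ {A B X Y} (α : Cell A B X Y) →
              subst₂ (λ T U → Cell T U X Y) (𝔸.⊗₀-identityʳ A) (𝔸.⊗₀-identityʳ B)
                (α ∣ idᵛ Y) ≈ α
    ⊘-assoc : ∀ {A B C D X Y X′ Y′ X″ Y″}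
              (α : Cell A B X Y) (β : Cell B C X′ Y′) (γ : Cell C D X″ Y″) →
              subst₂ (Cell A D) (++.assoc X X′ X″) (++.assoc Y Y′ Y″) ((α ⊘ β) ⊘ γ)
                ≈ α ⊘ (β ⊘ γ)
    ⊘-identityˡ : ∀ {A B X Y} (α : Cell A B X Y) →
              subst₂ (Cell A B) (++.identityˡ X) (++.identityˡ Y) (idʰ A ⊘ α) ≈ α
    ⊘-identityʳ : ∀ {A B X Y} (α : Cell A B X Y) →
              subst₂ (Cell A B) (++.identityʳ X) (++.identityʳ Y) (α ⊘ idʰ B) ≈ α
    idʰ-⊗ : ∀ A B → idʰ A ∣ idʰ B ≈ idʰ (A ⊗ B)
    idᵛ-⊗ : ∀ X Y → idᵛ X ⊘ idᵛ Y ≈ idᵛ (X ++ Y)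
    idʰ-I : idʰ I ≈ idᵛ []
    interchange : ∀ {A B C D E F X Y Z X′ Y′ Z′}
              (α : Cell A B X Y) (β : Cell B C X′ Y′)
              (γ : Cell D E Y Z) (δ : Cell E F Y′ Z′) →
              (α ⊘ β) ∣ (γ ⊘ δ) ≈ (α ∣ γ) ⊘ (β ∣ δ)

    yank°-∣ : ∀ A → subst₂ (λ T U → Cell T U [] []) (𝔸.⊗₀-identityʳ A) (𝔸.⊗₀-identityˡ A)
                      (s° A ∣ r° A) ≈ idʰ A
    yank°-⊘ : ∀ A → r° A ⊘ s° A ≈ idᵛ (A °)
    yank•-∣ : ∀ A → subst₂ (λ T U → Cell T U [] []) (𝔸.⊗₀-identityˡ A) (𝔸.⊗₀-identityʳ A)
                      (r• A ∣ s• A) ≈ idʰ A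
    yank•-⊘ : ∀ A → r• A ⊘ s• A ≈ idᵛ (A •)

    ⌜⌝-cong : ∀ {A B} {f g : Hom A B} → f 𝔸.≈ g → ⌜ f ⌝ ≈ ⌜ g ⌝
    ⌜⌝-⨟    : ∀ {A B C} (f : Hom A B) (g : Hom B C) → ⌜ f ⌝ ⊘ ⌜ g ⌝ ≈ ⌜ f 𝔸.⨟ g ⌝
    ⌜⌝-id   : ∀ A → ⌜ 𝔸.id A ⌝ ≈ idʰ A
    ⌜⌝-⊗    : ∀ {A B C D} (f : Hom A B) (g : Hom C D) → ⌜ f ⌝ ∣ ⌜ g ⌝ ≈ ⌜ f 𝔸.⊗₁ g ⌝

  𝒞 : SingleObjectDoubleCategory o o (o ⊔ ℓ) (o ⊔ ℓ ⊔ e)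
  𝒞 = record
    { HEdge = Obj ; _⊗ʰ_ = _⊗_ ; Iʰ = I ; isMonoidʰ = 𝔸.⊗-isMonoid
    ; VEdge = Exchange ; _⊗ᵛ_ = _++_ ; Iᵛ = [] ; isMonoidᵛ = ++-isMonoid
    ; Cell = Cell
    ; _≈_ = _≈_
    ; ≈-isEquivalence = record { refl = ≈-refl ; sym = ≈-sym ; trans = ≈-trans }
    ; _∣_ = _∣_ ; _⊘_ = _⊘_ ; idʰ = idʰ ; idᵛ = idᵛ
    ; ∣-cong = ∣-cong ; ⊘-cong = ⊘-cong
    ; ∣-assoc = ∣-assoc ; ∣-identityˡ = ∣-identityˡ ; ∣-identityʳ = ∣-identityʳ
    ; ⊘-assoc = ⊘-assoc ; ⊘-identityˡ = ⊘-identityˡ ; ⊘-identityʳ = ⊘-identityʳ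
    ; idʰ-⊗ = idʰ-⊗ ; idᵛ-⊗ = idᵛ-⊗ ; idʰ-I = idʰ-I
    ; interchange = interchange
    }

  -- Nested to the right, so that the units [] on the left and right boundaries
  -- vanish definitionally.
  map° : ∀ {A B} → Hom A B → Cell I I (A °) (B °)
  map° {A} {B} f = r° A ⊘ ⌜ f ⌝ ⊘ s° B

  map• : ∀ {A B} → Hom A B → Cell I I (B •) (A •)
  map• {A} {B} f = r• A ⊘ ⌜ f ⌝ ⊘ s• B

{-# OPTIONS --safe #-}
module Submission where

-- Bending a horizontal cell X → A° with r°_A turns it into a cell with bottom
-- A; under this correspondence f° becomes r°_A over ⌜f⌝, so that f ↦ f° is a
-- bijection onto the cells A° → B° as soon as f ↦ ⌜f⌝ is a bijection onto the
-- cells with trivial left and right boundary. It also gives isomorphisms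
-- A° ⊗ B° ≅ (B ⊗ A)°, corrected by the symmetry. Reflecting top and bottom
-- exchanges the two kinds of corners and yields the statements about f•,
-- where the symmetry is not needed.
--
-- ⌜_⌝ is surjective because a cell with trivial left boundary has a normal
-- form as a sequence of sends and receives. It is injective because the free
-- cornering acts on copresheaves on 𝔸: A acts by R_A P = P(– ⊗ A), A• by R_A,
-- A° by the right adjoint of R_A, and a cell with top A, bottom B, left X and
-- right Y becomes a transformation R_A T_Y ⇒ T_X R_B.

open import Defs
open import Level using (Level; _⊔_; Lift; lift; lower) renaming (suc to lsuc)
open import Data.List.Base using ([]; _∷_; _++_)
open import Data.List.Properties using (++-assoc; ++-identityˡ; ++-identityʳ)
open import Data.Product.Base using (_×_; _,_; ∃-syntax; Σ-syntax)
open import Relation.Binary.HeterogeneousEquality as ≅ using (_≅_; ≡-subst-removable; ≅-to-≡)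
open import Relation.Binary.PropositionalEquality
  using (_≡_; refl; sym; trans; cong; cong₂; subst; subst₂; isEquivalence)
open import Relation.Binary.Structures using (IsEquivalence)

-- Pasting calculus for cells whose boundaries agree up to equality.

module Pasting {h v c e} (𝔻 : SingleObjectDoubleCategory h v c e) where
  open SingleObjectDoubleCategory 𝔻
  open HorizontalCells 𝔻 public
    using (HCell; _⨟_; module ≈; _≋_; same; from≋; ≋-sym; _∙_; ∣-≋; ⊘-≋; transport; ⨟-≋;
           ⨟-cong; ⨟-assoc; ⨟-identityˡ; ⨟-identityʳ; ⊗-⨟)

  ≋-refl : ∀ {A B X Y} {α : Cell A B X Y} → α ≋ α
  ≋-refl = same ≈.refl

  ⨟-cong-≋ : ∀ {X Y Z X′ Y′ Z′} {f : HCell X Y} {g : HCell Y Z} {f′ : HCell X′ Y′}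
             {g′ : HCell Y′ Z′} → f ≋ f′ → g ≋ g′ → f ⨟ g ≋ f′ ⨟ g′
  ⨟-cong-≋ (same p) (same q) = same (⨟-cong p q)

  transportᵛ : ∀ {A B X X′ Y Y′} (p : X ≡ X′) (q : Y ≡ Y′) (α : Cell A B X Y) →
               α ≋ subst₂ (Cell A B) p q α
  transportᵛ refl refl α = ≋-refl

  cast : ∀ {A A′ B B′ X X′ Y Y′} → A ≡ A′ → B ≡ B′ → X ≡ X′ → Y ≡ Y′ →
         Cell A B X Y → Cell A′ B′ X′ Y′
  cast refl refl refl refl α = α

  uncast : ∀ {A A′ B B′ X X′ Y Y′} {p : A ≡ A′} {q : B ≡ B′} {s : X ≡ X′} {t : Y ≡ Y′}
           {α : Cell A B X Y} → cast p q s t α ≋ α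
  uncast {p = refl} {refl} {refl} {refl} = ≋-refl

  idʰ-≋ : ∀ {A A′} → A ≡ A′ → idʰ A ≋ idʰ A′
  idʰ-≋ refl = ≋-refl

  assocʰ : ∀ {A B C D E F X Y Z W} (α : Cell A B X Y) (β : Cell C D Y Z) (γ : Cell E F Z W) →
           (α ∣ β) ∣ γ ≋ α ∣ (β ∣ γ)
  assocʰ α β γ = transport _ _ _ ∙ same (∣-assoc α β γ)

  unitʰˡ : ∀ {A B X Y} (α : Cell A B X Y) → idᵛ X ∣ α ≋ α
  unitʰˡ α = transport _ _ _ ∙ same (∣-identityˡ α)

  unitʰʳ : ∀ {A B X Y} (α : Cell A B X Y) → α ∣ idᵛ Y ≋ α
  unitʰʳ α = transport _ _ _ ∙ same (∣-identityʳ α)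

  idʰIˡ : ∀ {A B Y} (α : Cell A B Iᵛ Y) → idʰ Iʰ ∣ α ≋ α
  idʰIˡ α = ∣-≋ (same idʰ-I) ≋-refl ∙ unitʰˡ α

  idʰIʳ : ∀ {A B X} (α : Cell A B X Iᵛ) → α ∣ idʰ Iʰ ≋ α
  idʰIʳ α = ∣-≋ ≋-refl (same idʰ-I) ∙ unitʰʳ α

  assocᵛ : ∀ {A B C D X Y X′ Y′ X″ Y″}
           (α : Cell A B X Y) (β : Cell B C X′ Y′) (γ : Cell C D X″ Y″) →
           (α ⊘ β) ⊘ γ ≋ α ⊘ (β ⊘ γ)
  assocᵛ α β γ = transportᵛ _ _ _ ∙ same (⊘-assoc α β γ)

  unitᵛˡ : ∀ {A B X Y} (α : Cell A B X Y) → idʰ A ⊘ α ≋ α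
  unitᵛˡ α = transportᵛ _ _ _ ∙ same (⊘-identityˡ α)

  unitᵛʳ : ∀ {A B X Y} (α : Cell A B X Y) → α ⊘ idʰ B ≋ α
  unitᵛʳ α = transportᵛ _ _ _ ∙ same (⊘-identityʳ α)

  exchange : ∀ {A B C D E F X Y Z X′ Y′ Z′}
             (α : Cell A B X Y) (β : Cell B C X′ Y′)
             (γ : Cell D E Y Z) (δ : Cell E F Y′ Z′) →
             (α ⊘ β) ∣ (γ ⊘ δ) ≋ (α ∣ γ) ⊘ (β ∣ δ)
  exchange α β γ δ = same (interchange α β γ δ)

-- Corner structures (chosen conjoints) and bending of horizontal cells.

record CornerStructure {h v c e} (𝔻 : SingleObjectDoubleCategory h v c e) :
                       Set (h ⊔ v ⊔ c ⊔ e) where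
  open SingleObjectDoubleCategory 𝔻
  open Pasting 𝔻 using (_≋_)
  field
    F      : HEdge → VEdge
    s      : ∀ A → Cell A Iʰ Iᵛ (F A)
    r      : ∀ A → Cell Iʰ A (F A) Iᵛ
    yank-∣ : ∀ A → s A ∣ r A ≋ idʰ A
    yank-⊘ : ∀ A → r A ⊘ s A ≋ idᵛ (F A)

-- Developed for an abstract corner structure, so that the results apply both to `s°`, `r°` in the
-- free cornering and to `r•`, `s•` in its reflection.
module Corners {h v c e} (𝔻 : SingleObjectDoubleCategory h v c e) (K : CornerStructure 𝔻) where
  open SingleObjectDoubleCategory 𝔻 hiding (_≈_)
  open Pasting 𝔻
  open CornerStructure K

  dropI : ∀ {A B X Y} → Cell (Iʰ ⊗ʰ A) (Iʰ ⊗ʰ B) X Y → Cell A B X Y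
  dropI = cast (⊗ʰ-identityˡ _) (⊗ʰ-identityˡ _) refl refl

  bend : ∀ {X C} → HCell X (F C) → Cell Iʰ C X Iᵛ
  bend f = dropI (f ∣ r _)

  unbend : ∀ {X C} → Cell Iʰ C X Iᵛ → HCell X (F C)
  unbend k = cast refl refl (⊗ᵛ-identityʳ _) (⊗ᵛ-identityˡ _) (k ⊘ s _)

  -- Splitting `r C` as `idʰ Iʰ` over `r C` lines it up with `k ⊘ s C`; interchange then puts `s C`
  -- next to `r C`, and they yank to an identity.
  unbend-∣r : ∀ {X C} (k : Cell Iʰ C X Iᵛ) → unbend k ∣ r C ≋ k
  unbend-∣r {C = C} k =
    ∣-≋ uncast (≋-sym (unitᵛˡ (r C)))
      ∙ exchange k (s C) (idʰ Iʰ) (r C)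
      ∙ ⊘-≋ (idʰIʳ k) (yank-∣ C)
      ∙ unitᵛʳ k

  bend-unbend : ∀ {X C} (k : Cell Iʰ C X Iᵛ) → bend (unbend k) ≋ k
  bend-unbend k = uncast ∙ unbend-∣r k

  -- The identity on `F C` to the right of `f` is replaced, by the other yanking equation, with
  -- `r C` over `s C`; interchange leaves `f ∣ r C` over `s C`.
  unbend-bend : ∀ {X C} (f : HCell X (F C)) → f ≋ unbend (bend f)
  unbend-bend {X} {C} f =
    ≋-sym (unitʰʳ f)
      ∙ ∣-≋ (≋-sym (unitᵛʳ f)) (≋-sym (yank-⊘ C))
      ∙ exchange f (idʰ Iʰ) (r C) (s C)
      ∙ ⊘-≋ (≋-sym uncast) (idʰIˡ (s C))
      ∙ ≋-sym uncast

  unbend-cong : ∀ {X X′ C C′} {k : Cell Iʰ C X Iᵛ} {k′ : Cell Iʰ C′ X′ Iᵛ} →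
                k ≋ k′ → unbend k ≋ unbend k′
  unbend-cong (same p) = uncast ∙ ⊘-≋ (same p) ≋-refl ∙ ≋-sym uncast

  -- The main tool for equations between horizontal cells: paste `r` on the right and compare what
  -- comes out at the bottom. The objects `C` and `C′` need only agree up to `_≡_`, as happens in
  -- the associativity and unit laws of `ν`.
  bend-injective : ∀ {X X′ C C′} {f : HCell X (F C)} {f′ : HCell X′ (F C′)} → C ≡ C′ →
                   f ∣ r C ≋ f′ ∣ r C′ → f ≋ f′
  bend-injective {f = f} {f′} refl p =
    unbend-bend f ∙ unbend-cong (uncast ∙ p ∙ ≋-sym uncast) ∙ ≋-sym (unbend-bend f′)

  -- Common source of `slide-receive` and `⨟ν-∣r`: by interchange the upper part of the right
  -- boundary is bent while the lower part meets `k`.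
  bend-slide : ∀ {X C X′ Y′ Z D} (f : HCell X (F C)) (g : HCell X′ Y′) (k : Cell C D Y′ Z) →
               (f ⊘ g) ∣ (r C ⊘ k) ≋ bend f ⊘ dropI (g ∣ k)
  bend-slide {C = C} f g k =
    exchange f g (r C) k ∙ ⊘-≋ (≋-sym uncast) (≋-sym uncast)

  -- The action of a corner structure on cells with trivial left and right boundary.

  VCell : HEdge → HEdge → Set c
  VCell A B = Cell A B Iᵛ Iᵛ

  receive : ∀ {A B} → VCell A B → Cell Iʰ B (F A) Iᵛ
  receive {A} u = cast refl refl (⊗ᵛ-identityʳ _) (⊗ᵛ-identityʳ _) (r A ⊘ u)

  -- The construction of f° with an arbitrary cell in place of `⌜ f ⌝`; at this generality it is
  -- invertible by the corner laws alone.
  map : ∀ {A B} → VCell A B → HCell (F A) (F B)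
  map u = unbend (receive u)

  map-≋ : ∀ {A B} (u : VCell A B) → map u ≋ r A ⊘ (u ⊘ s B)
  map-≋ {A} {B} u = uncast ∙ ⊘-≋ uncast ≋-refl ∙ assocᵛ (r A) u (s B)

  slide-receive : ∀ {X A B} (f : HCell X (F A)) (u : VCell A B) → f ∣ receive u ≋ bend f ⊘ u
  slide-receive {A = A} f u =
    ∣-≋ (≋-sym (unitᵛʳ f) ∙ ⊘-≋ ≋-refl (same idʰ-I)) uncast
      ∙ bend-slide f (idᵛ Iᵛ) u
      ∙ ⊘-≋ ≋-refl (uncast ∙ unitʰˡ u)

  -- Bending turns postcomposition with `map u` into vertical composition with `u`, so that
  -- functoriality of `map` comes down to `assocᵛ`.
  ⨟map-∣r : ∀ {X A B} (f : HCell X (F A)) (u : VCell A B) → (f ⨟ map u) ∣ r B ≋ bend f ⊘ u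
  ⨟map-∣r {B = B} f u =
    ∣-≋ (⨟-≋ f (map u)) ≋-refl ∙ assocʰ f (map u) (r B)
      ∙ ∣-≋ ≋-refl (unbend-∣r (receive u)) ∙ slide-receive f u

  map-cong : ∀ {A A′ B B′} {u : VCell A B} {w : VCell A′ B′} → u ≋ w → map u ≋ map w
  map-cong (same p) = unbend-cong (uncast ∙ ⊘-≋ ≋-refl (same p) ∙ ≋-sym uncast)

  map-id : ∀ A → map (idʰ A) ≋ idᵛ (F A)
  map-id A = map-≋ (idʰ A) ∙ ⊘-≋ ≋-refl (unitᵛˡ (s A)) ∙ yank-⊘ A

  map-⨟ : ∀ {A B C} (u : VCell A B) (w : VCell B C) {z : VCell A C} → u ⊘ w ≋ z →
          map u ⨟ map w ≋ map z
  map-⨟ {A} u w {z} p = bend-injective refl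
    (⨟map-∣r (map u) w
      ∙ ⊘-≋ (bend-unbend (receive u) ∙ uncast) ≋-refl
      ∙ assocᵛ (r A) u w
      ∙ ⊘-≋ ≋-refl p
      ∙ ≋-sym uncast
      ∙ ≋-sym (unbend-∣r (receive z)))

  -- Both ends of `f` are straightened: `s A` feeds the left one from the top, and bending leads the
  -- right one to the bottom.
  unmap : ∀ {A B} → HCell (F A) (F B) → VCell A B
  unmap {A} f = cast (⊗ʰ-identityʳ _) (⊗ʰ-identityˡ _) refl refl (s A ∣ bend f)

  map-unmap : ∀ {A B} (f : HCell (F A) (F B)) → map (unmap f) ≋ f
  map-unmap {A} {B} f = bend-injective refl
    (unbend-∣r (receive (unmap f)) ∙ uncast
      ∙ ⊘-≋ (≋-sym (idʰIʳ (r A))) uncast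
      ∙ ≋-sym (exchange (r A) (s A) (idʰ Iʰ) (bend f))
      ∙ ∣-≋ (yank-⊘ A) (unitᵛˡ (bend f))
      ∙ unitʰˡ (bend f)
      ∙ uncast)

  unmap-map : ∀ {A B} (u : VCell A B) → unmap (map u) ≋ u
  unmap-map {A} u =
    uncast ∙ ∣-≋ (≋-sym (unitᵛʳ (s A))) (bend-unbend (receive u) ∙ uncast)
      ∙ exchange (s A) (idʰ Iʰ) (r A) u
      ∙ ⊘-≋ (yank-∣ A) (idʰIˡ u)
      ∙ unitᵛˡ u

  unmap-cong : ∀ {A B} {f g : HCell (F A) (F B)} → f ≋ g → unmap f ≋ unmap g
  unmap-cong {A} (same p) =
    uncast ∙ ∣-≋ (≋-refl {α = s A}) (uncast ∙ ∣-≋ (same p) ≋-refl ∙ ≋-sym uncast) ∙ ≋-sym uncast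

  map-injective : ∀ {A B} {u w : VCell A B} → map u ≋ map w → u ≋ w
  map-injective {u = u} {w} p = ≋-sym (unmap-map u) ∙ unmap-cong p ∙ unmap-map w

  -- Comparison of `F A ⊗ᵛ F B` with `F (B ⊗ʰ A)`.

  receiveˡ : ∀ B A → Cell A (B ⊗ʰ A) (F B) Iᵛ
  receiveˡ B A = cast (⊗ʰ-identityˡ A) refl refl refl (r B ∣ idʰ A)

  sendʳ : ∀ B A → Cell (B ⊗ʰ A) B Iᵛ (F A)
  sendʳ B A = cast refl (⊗ʰ-identityʳ B) refl refl (idʰ B ∣ s A)

  receive₂ : ∀ A B → Cell Iʰ (B ⊗ʰ A) (F A ⊗ᵛ F B) Iᵛ
  receive₂ A B = cast refl refl refl (⊗ᵛ-identityʳ Iᵛ) (r A ⊘ receiveˡ B A)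

  send₂ : ∀ A B → Cell (B ⊗ʰ A) Iʰ Iᵛ (F A ⊗ᵛ F B)
  send₂ A B = cast refl refl (⊗ᵛ-identityʳ Iᵛ) refl (sendʳ B A ⊘ s B)

  -- A arrives before B and so ends up to the right of it.
  ν : ∀ A B → HCell (F A ⊗ᵛ F B) (F (B ⊗ʰ A))
  ν A B = unbend (receive₂ A B)

  ν⁻¹ : ∀ A B → HCell (F (B ⊗ʰ A)) (F A ⊗ᵛ F B)
  ν⁻¹ A B = cast refl refl (⊗ᵛ-identityʳ _) (⊗ᵛ-identityˡ _) (r (B ⊗ʰ A) ⊘ send₂ A B)

  ⨟ν-∣r : ∀ {X A B Y} (f : HCell X (F A)) (g : HCell Y (F B)) →
          ((f ⊘ g) ⨟ ν A B) ∣ r (B ⊗ʰ A) ≋ bend f ⊘ dropI (g ∣ receiveˡ B A)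
  ⨟ν-∣r {A = A} {B} f g =
    ∣-≋ (⨟-≋ _ _) ≋-refl ∙ assocʰ _ _ _
      ∙ ∣-≋ ≋-refl (unbend-∣r (receive₂ A B) ∙ uncast)
      ∙ bend-slide f g (receiveˡ B A)

  ∣receiveˡ : ∀ {X B} (g : HCell X (F B)) A → g ∣ receiveˡ B A ≋ bend g ∣ idʰ A
  ∣receiveˡ g A = ∣-≋ ≋-refl uncast ∙ ≋-sym (assocʰ _ _ _) ∙ ∣-≋ (≋-sym uncast) ≋-refl

  -- Once bent, both sides let `A` arrive, then `C`. They differ in whether `u` acts before or after
  -- the arrival of `C`, and cells standing side by side slide past each other by interchange.
  ν-natural : ∀ {A B C D} (u : VCell A B) (w : VCell C D) {z : VCell (C ⊗ʰ A) (D ⊗ʰ B)} →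
              w ∣ u ≋ z → (map u ⊘ map w) ⨟ ν B D ≋ ν A C ⨟ map z
  ν-natural {A} {B} {C} {D} u w {z} p = bend-injective refl
    (⨟ν-∣r (map u) (map w)
      ∙ ⊘-≋ (bend-unbend (receive u) ∙ uncast)
            (uncast ∙ ∣receiveˡ (map w) B
              ∙ ∣-≋ (bend-unbend (receive w)) ≋-refl ∙ ≋-sym uncast)
      ∙ assocᵛ (r A) u below
      ∙ ⊘-≋ ≋-refl
          (⊘-≋ (≋-sym (idʰIˡ u)) uncast
            ∙ ≋-sym (exchange (idʰ Iʰ) (receive w) u (idʰ B))
            ∙ ∣-≋ (unitᵛˡ (receive w) ∙ uncast) (unitᵛʳ u ∙ ≋-sym (unitᵛˡ u))
            ∙ exchange (r C) w (idʰ A) u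
            ∙ ⊘-≋ (≋-sym uncast) p)
      ∙ ≋-sym (assocᵛ (r A) (receiveˡ C A) z)
      ∙ ⊘-≋ (≋-sym uncast ∙ ≋-sym (bend-unbend (receive₂ A C))) ≋-refl
      ∙ ≋-sym (⨟map-∣r (ν A C) z))
    where
    below : Cell B (D ⊗ʰ B) (F C) Iᵛ
    below = cast (⊗ʰ-identityˡ B) refl refl refl (receive w ∣ idʰ B)

  receiveˡ-⊗ : ∀ C B A → receiveˡ C (B ⊗ʰ A) ≋ receiveˡ C B ∣ idʰ A
  receiveˡ-⊗ C B A =
    uncast ∙ ∣-≋ ≋-refl (≋-sym (same (idʰ-⊗ B A))) ∙ ≋-sym (assocʰ _ _ _)
      ∙ ∣-≋ (≋-sym uncast) ≋-refl

  -- Once bent, both sides let `A`, `B` and `C` arrive in turn, each to the left of its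
  -- predecessors; the bottom edges differ only in their bracketing.
  ν-associative : ∀ A B C → (ν A B ⊘ idᵛ (F C)) ⨟ ν (B ⊗ʰ A) C
                              ≋ (idᵛ (F A) ⊘ ν B C) ⨟ ν A (C ⊗ʰ B)
  ν-associative A B C = bend-injective (sym (⊗ʰ-assoc C B A))
    (⨟ν-∣r (ν A B) (idᵛ (F C))
      ∙ ⊘-≋ (bend-unbend (receive₂ A B) ∙ uncast) (uncast ∙ unitʰˡ _)
      ∙ assocᵛ (r A) (receiveˡ B A) (receiveˡ C (B ⊗ʰ A))
      ∙ ⊘-≋ (≋-sym (unitʰˡ (r A)) ∙ ≋-sym uncast)
          (⊘-≋ uncast (receiveˡ-⊗ C B A)
            ∙ ≋-sym (exchange (r B) (receiveˡ C B) (idʰ A) (idʰ A))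
            ∙ ∣-≋ (≋-sym uncast ∙ ≋-sym (bend-unbend (receive₂ B C))) (unitᵛˡ (idʰ A))
            ∙ ≋-sym (∣receiveˡ (ν B C) A)
            ∙ ≋-sym uncast)
      ∙ ≋-sym (⨟ν-∣r (idᵛ (F A)) (ν B C)))

  -- At the unit the corners have trivial top and bottom, so they are themselves horizontal cells,
  -- and yanking makes them inverse to each other.
  ε : HCell Iᵛ (F Iʰ)
  ε = s Iʰ

  ε⁻¹ : HCell (F Iʰ) Iᵛ
  ε⁻¹ = r Iʰ

  ε-inverseˡ : ε ⨟ ε⁻¹ ≋ idᵛ Iᵛ
  ε-inverseˡ = ⨟-≋ _ _ ∙ yank-∣ Iʰ ∙ same idʰ-I

  ε-inverseʳ : ε⁻¹ ⨟ ε ≋ idᵛ (F Iʰ)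
  ε-inverseʳ = ⨟-≋ _ _ ∙ ∣-≋ (≋-sym (unitᵛʳ ε⁻¹)) (≋-sym (unitᵛˡ ε))
    ∙ exchange ε⁻¹ (idʰ Iʰ) (idʰ Iʰ) ε
    ∙ ⊘-≋ (idʰIʳ ε⁻¹) (idʰIˡ ε)
    ∙ yank-⊘ Iʰ

  receiveˡ-I : ∀ A → receiveˡ A Iʰ ≋ r A
  receiveˡ-I A = uncast ∙ idʰIʳ (r A)

  ν-unitalˡ : ∀ A → (ε ⊘ idᵛ (F A)) ⨟ ν Iʰ A ≋ idᵛ (F A)
  ν-unitalˡ A = bend-injective (⊗ʰ-identityʳ A)
    (⨟ν-∣r ε (idᵛ (F A))
      ∙ ⊘-≋ (uncast ∙ yank-∣ Iʰ) (uncast ∙ unitʰˡ _ ∙ receiveˡ-I A)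
      ∙ unitᵛˡ (r A) ∙ ≋-sym (unitʰˡ (r A)))

  ν-unitalʳ : ∀ A → (idᵛ (F A) ⊘ ε) ⨟ ν A Iʰ ≋ idᵛ (F A)
  ν-unitalʳ A = bend-injective (⊗ʰ-identityˡ A)
    (⨟ν-∣r (idᵛ (F A)) ε
      ∙ ⊘-≋ (uncast ∙ unitʰˡ (r A))
            (uncast ∙ ∣receiveˡ ε A ∙ ∣-≋ (uncast ∙ yank-∣ Iʰ) ≋-refl ∙ same (idʰ-⊗ Iʰ A)
              ∙ idʰ-≋ (⊗ʰ-identityˡ A))
      ∙ unitᵛʳ (r A)
      ∙ ≋-sym (unitʰˡ (r A)))

  -- The arrival of `B` on the left and the departure of `A` on the right do not interact. `cross`
  -- swaps them, after which each arrival is followed directly by its own departure and is yanked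
  -- away.
  ν-inverseˡ : ∀ A B → ν A B ⨟ ν⁻¹ A B ≋ idᵛ (F A ⊗ᵛ F B)
  ν-inverseˡ A B =
    ⨟-≋ _ _
      ∙ ∣-≋ (≋-sym (unitᵛʳ (ν A B))) uncast
      ∙ exchange (ν A B) (idʰ Iʰ) (r (B ⊗ʰ A)) (send₂ A B)
      ∙ ⊘-≋ (unbend-∣r (receive₂ A B)) (idʰIˡ (send₂ A B))
      ∙ ⊘-≋ uncast uncast
      ∙ assocᵛ (r A) (receiveˡ B A) (sendʳ B A ⊘ s B)
      ∙ ⊘-≋ ≋-refl
          (≋-sym (assocᵛ (receiveˡ B A) (sendʳ B A) (s B))
            ∙ ⊘-≋ cross ≋-refl
            ∙ assocᵛ (s A) (r B) (s B))
      ∙ ≋-sym (assocᵛ (r A) (s A) (r B ⊘ s B))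
      ∙ ⊘-≋ (yank-⊘ A) (yank-⊘ B)
      ∙ same (idᵛ-⊗ (F A) (F B))
    where
    cross : receiveˡ B A ⊘ sendʳ B A ≋ s A ⊘ r B
    cross =
      ⊘-≋ uncast uncast
        ∙ ≋-sym (exchange (r B) (idʰ B) (idʰ A) (s A))
        ∙ ∣-≋ (unitᵛʳ (r B) ∙ ≋-sym (unitᵛˡ (r B))) (unitᵛˡ (s A) ∙ ≋-sym (unitᵛʳ (s A)))
        ∙ exchange (idʰ Iʰ) (r B) (s A) (idʰ Iʰ)
        ∙ ⊘-≋ (idʰIˡ (s A)) (idʰIʳ (r B))

  -- Here the corners meet side by side: `s A` faces `r A` and `s B` faces `r B`, so the horizontal
  -- yanking equation applies twice.
  ν-inverseʳ : ∀ A B → ν⁻¹ A B ⨟ ν A B ≋ idᵛ (F (B ⊗ʰ A))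
  ν-inverseʳ A B = bend-injective refl
    (∣-≋ (⨟-≋ _ _) ≋-refl ∙ assocʰ _ _ _
      ∙ ∣-≋ uncast (unbend-∣r (receive₂ A B) ∙ ≋-sym (unitᵛˡ (receive₂ A B)))
      ∙ exchange (r (B ⊗ʰ A)) (send₂ A B) (idʰ Iʰ) (receive₂ A B)
      ∙ ⊘-≋ (idʰIʳ (r (B ⊗ʰ A)))
          (∣-≋ uncast uncast
            ∙ exchange (sendʳ B A) (s B) (r A) (receiveˡ B A)
            ∙ ⊘-≋ (∣-≋ uncast ≋-refl ∙ assocʰ _ _ _ ∙ ∣-≋ ≋-refl (yank-∣ A)
                    ∙ same (idʰ-⊗ B A))
                  (∣-≋ ≋-refl uncast ∙ ≋-sym (assocʰ _ _ _) ∙ ∣-≋ (yank-∣ B) ≋-refl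
                    ∙ same (idʰ-⊗ B A))
            ∙ unitᵛˡ (idʰ (B ⊗ʰ A)))
      ∙ unitᵛʳ (r (B ⊗ʰ A))
      ∙ ≋-sym (unitʰˡ (r (B ⊗ʰ A))))

-- Exchange of top and bottom in a double category.

module Reflection {h v c e} (𝔻 : SingleObjectDoubleCategory h v c e) where
  open SingleObjectDoubleCategory 𝔻
  open Pasting 𝔻 hiding (_⨟_)

  -- Reversing `_⊗ᵛ_` is forced by the exchange of top and bottom; it also cancels the reversal of
  -- factors in `ν`.
  reflected : SingleObjectDoubleCategory h v c e
  reflected = record
    { HEdge = HEdge ; _⊗ʰ_ = _⊗ʰ_ ; Iʰ = Iʰ ; isMonoidʰ = isMonoidʰ
    ; VEdge = VEdge ; _⊗ᵛ_ = λ X Y → Y ⊗ᵛ X ; Iᵛ = Iᵛ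
    ; isMonoidᵛ = record
      { isSemigroup = record
        { isMagma = record { isEquivalence = isEquivalence ; ∙-cong = λ p q → cong₂ _⊗ᵛ_ q p }
        ; assoc = λ X Y Z → sym (⊗ᵛ-assoc Z Y X)
        }
      ; identity = ⊗ᵛ-identityʳ , ⊗ᵛ-identityˡ
      }
    ; Cell = λ A B → Cell B A
    ; _≈_ = _≈_
    ; ≈-isEquivalence = ≈-isEquivalence
    ; _∣_ = _∣_ ; _⊘_ = λ α β → β ⊘ α ; idʰ = idʰ ; idᵛ = idᵛ
    ; ∣-cong = ∣-cong ; ⊘-cong = λ p q → ⊘-cong q p
    ; ∣-assoc = λ α β γ → from≋ (≋-sym (transport′ _ _ _) ∙ assocʰ α β γ)
    ; ∣-identityˡ = λ α → from≋ (≋-sym (transport′ _ _ _) ∙ unitʰˡ α)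
    ; ∣-identityʳ = λ α → from≋ (≋-sym (transport′ _ _ _) ∙ unitʰʳ α)
    ; ⊘-assoc = λ α β γ → from≋ (≋-sym (transportᵛ _ _ _) ∙ ≋-sym (assocᵛ γ β α))
    ; ⊘-identityˡ = λ α → from≋ (≋-sym (transportᵛ _ _ _) ∙ unitᵛʳ α)
    ; ⊘-identityʳ = λ α → from≋ (≋-sym (transportᵛ _ _ _) ∙ unitᵛˡ α)
    ; idʰ-⊗ = idʰ-⊗ ; idᵛ-⊗ = λ X Y → idᵛ-⊗ Y X ; idʰ-I = idʰ-I
    ; interchange = λ α β γ δ → interchange β α δ γ
    }
    where
    transport′ : ∀ {A A′ B B′ X Y} (p : A ≡ A′) (q : B ≡ B′) (α : Cell B A X Y) →
                 α ≋ subst₂ (λ T U → Cell U T X Y) p q α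
    transport′ refl refl α = ≋-refl

  private module 𝔻ᵛ = Pasting reflected

  reflect : ∀ {A B X Y A′ B′ X′ Y′} {α : Cell A B X Y} {β : Cell A′ B′ X′ Y′} →
            𝔻ᵛ._≋_ α β → α ≋ β
  reflect (𝔻ᵛ.same p) = same p

  unreflect : ∀ {A B X Y A′ B′ X′ Y′} {α : Cell A B X Y} {β : Cell A′ B′ X′ Y′} →
              α ≋ β → 𝔻ᵛ._≋_ α β
  unreflect (same p) = 𝔻ᵛ.same p

  reflect-⨟ : ∀ {X Y Z} (f : HCell X Y) (g : HCell Y Z) →
              HorizontalCells._⨟_ 𝔻 f g ≋ HorizontalCells._⨟_ reflected f g
  reflect-⨟ f g = ⨟-≋ f g ∙ ≋-sym (reflect (𝔻ᵛ.⨟-≋ f g))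

-- Normal forms for cells with trivial left boundary, and surjectivity of `⌜_⌝`.

module NormalForms {o ℓ e} (𝔸 : SymmetricStrictMonoidalCategory o ℓ e) where
  private module 𝔸 = SymmetricStrictMonoidalCategory 𝔸
  open 𝔸 using (Obj; Hom; I; id; _⨟_; eqToHom) renaming (_⊗₀_ to _⊗_)
  open FreeCornering 𝔸
  open Pasting 𝒞 hiding (_⨟_)

  -- A cell with trivial left boundary, read from top to bottom, sends and
  -- receives the objects on its right boundary in turn.
  data NF (C D : Obj) : Exchange → Set (o ⊔ ℓ) where
    return : Hom C D → NF C D []
    send   : ∀ {X} E A → Hom C (E ⊗ A) → NF (E ⊗ I) D X → NF C D ((A , ○) ∷ X)
    recv   : ∀ {X} E A → Hom C (E ⊗ I) → NF (E ⊗ A) D X → NF C D ((A , ●) ∷ X)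

  ⟪_⟫ : ∀ {C D X} → NF C D X → Cell C D [] X
  ⟪ return f ⟫     = ⌜ f ⌝
  ⟪ send E A f n ⟫ = ⌜ f ⌝ ⊘ ((idʰ E ∣ s° A) ⊘ ⟪ n ⟫)
  ⟪ recv E A f n ⟫ = ⌜ f ⌝ ⊘ ((idʰ E ∣ r• A) ⊘ ⟪ n ⟫)

  castNF : ∀ {C C′ D D′ X} → C ≡ C′ → D ≡ D′ → NF C D X → NF C′ D′ X
  castNF refl refl n = n

  ⟪castNF⟫ : ∀ {C C′ D D′ X} (p : C ≡ C′) (q : D ≡ D′) (n : NF C D X) → ⟪ castNF p q n ⟫ ≋ ⟪ n ⟫
  ⟪castNF⟫ refl refl n = ≋-refl

  ⌜eqToHom⌝ : ∀ {A B} (p : A ≡ B) → ⌜ eqToHom p ⌝ ≋ idʰ A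
  ⌜eqToHom⌝ refl = same (⌜⌝-id _)

  ⌜⨟⌝ : ∀ {A B C} (f : Hom A B) (g : Hom B C) → ⌜ f ⨟ g ⌝ ≋ ⌜ f ⌝ ⊘ ⌜ g ⌝
  ⌜⨟⌝ f g = same (≈-sym (⌜⌝-⨟ f g))

  _◃_ : ∀ {C C′ D X} → Hom C C′ → NF C′ D X → NF C D X
  f ◃ return g     = return (f ⨟ g)
  f ◃ send E A g n = send E A (f ⨟ g) n
  f ◃ recv E A g n = recv E A (f ⨟ g) n

  ⟪◃⟫ : ∀ {C C′ D X} (f : Hom C C′) (n : NF C′ D X) → ⟪ f ◃ n ⟫ ≋ ⌜ f ⌝ ⊘ ⟪ n ⟫
  ⟪◃⟫ f (return g)     = ⌜⨟⌝ f g
  ⟪◃⟫ f (send E A g n) = ⊘-≋ (⌜⨟⌝ f g) ≋-refl ∙ assocᵛ ⌜ f ⌝ ⌜ g ⌝ _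
  ⟪◃⟫ f (recv E A g n) = ⊘-≋ (⌜⨟⌝ f g) ≋-refl ∙ assocᵛ ⌜ f ⌝ ⌜ g ⌝ _

  join : ∀ {C D E X Y} → NF C D X → NF D E Y → NF C E (X ++ Y)
  join (return f)     m = f ◃ m
  join (send E A f n) m = send E A f (join n m)
  join (recv E A f n) m = recv E A f (join n m)

  ⟪join⟫ : ∀ {C D E X Y} (n : NF C D X) (m : NF D E Y) → ⟪ join n m ⟫ ≋ ⟪ n ⟫ ⊘ ⟪ m ⟫
  ⟪join⟫ (return f)     m = ⟪◃⟫ f m
  ⟪join⟫ (send E A f n) m =
    ⊘-≋ ≋-refl (⊘-≋ ≋-refl (⟪join⟫ n m) ∙ ≋-sym (assocᵛ (idʰ E ∣ s° A) ⟪ n ⟫ ⟪ m ⟫))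
      ∙ ≋-sym (assocᵛ ⌜ f ⌝ _ ⟪ m ⟫)
  ⟪join⟫ (recv E A f n) m =
    ⊘-≋ ≋-refl (⊘-≋ ≋-refl (⟪join⟫ n m) ∙ ≋-sym (assocᵛ (idʰ E ∣ r• A) ⟪ n ⟫ ⟪ m ⟫))
      ∙ ≋-sym (assocᵛ ⌜ f ⌝ _ ⟪ m ⟫)

  -- Each `send` or `recv` accounts for exactly one letter of the right boundary, so a normal form
  -- can be cut wherever that boundary can. This is what pasting with a vertical composite requires.
  split : ∀ {C E} X {Y} (n : NF C E (X ++ Y)) →
          ∃[ D ] Σ[ n₁ ∈ NF C D X ] Σ[ n₂ ∈ NF D E Y ] ⟪ n₁ ⟫ ⊘ ⟪ n₂ ⟫ ≋ ⟪ n ⟫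
  split {C} [] n = C , return (id C) , n , ⊘-≋ (same (⌜⌝-id C)) ≋-refl ∙ unitᵛˡ ⟪ n ⟫
  split ((A , ○) ∷ X) (send E A f n) with split X n
  ... | D , n₁ , n₂ , p = D , send E A f n₁ , n₂ ,
    assocᵛ ⌜ f ⌝ _ ⟪ n₂ ⟫ ∙ ⊘-≋ ≋-refl (assocᵛ (idʰ E ∣ s° A) ⟪ n₁ ⟫ ⟪ n₂ ⟫ ∙ ⊘-≋ ≋-refl p)
  split ((A , ●) ∷ X) (recv E A f n) with split X n
  ... | D , n₁ , n₂ , p = D , recv E A f n₁ , n₂ ,
    assocᵛ ⌜ f ⌝ _ ⟪ n₂ ⟫ ∙ ⊘-≋ ≋-refl (assocᵛ (idʰ E ∣ r• A) ⟪ n₁ ⟫ ⟪ n₂ ⟫ ∙ ⊘-≋ ≋-refl p)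

  -- An arbitrary normal form on the left makes the induction on `α` possible: inside `α ∣ β` the
  -- left boundary of `β` need not be trivial, even when that of the whole is. Corners with a left
  -- boundary consume a matching `send` or `recv` by yanking.
  paste : ∀ {A B C D X Y} (α : Cell A B X Y) (n : NF C D X) →
          Σ[ m ∈ NF (C ⊗ A) (D ⊗ B) Y ] ⟪ m ⟫ ≋ ⟪ n ⟫ ∣ α
  paste {D = D} (s° A) (return f) =
    send D A (f 𝔸.⊗₁ id A) (return (id (D ⊗ I))) ,
    ⊘-≋ (same (≈-sym (⌜⌝-⊗ f (id A))) ∙ ∣-≋ ≋-refl (same (⌜⌝-id A)))
        (⊘-≋ ≋-refl (same (⌜⌝-id _)) ∙ unitᵛʳ (idʰ D ∣ s° A))
      ∙ ≋-sym (exchange ⌜ f ⌝ (idʰ D) (idʰ A) (s° A))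
      ∙ ∣-≋ (unitᵛʳ ⌜ f ⌝) (unitᵛˡ (s° A))
  paste {D = D} (r• A) (return f) =
    recv D A (f 𝔸.⊗₁ id I) (return (id (D ⊗ A))) ,
    ⊘-≋ (same (≈-sym (⌜⌝-⊗ f (id I))) ∙ ∣-≋ ≋-refl (same (⌜⌝-id I)))
        (⊘-≋ ≋-refl (same (⌜⌝-id _)) ∙ unitᵛʳ (idʰ D ∣ r• A))
      ∙ ≋-sym (exchange ⌜ f ⌝ (idʰ D) (idʰ I) (r• A))
      ∙ ∣-≋ (unitᵛʳ ⌜ f ⌝) (unitᵛˡ (r• A))
  -- The left boundary `A °` forces the normal form to be a single `send` of `A`. Sender and
  -- receiver yank, leaving `A` to run from top to bottom beside `E`; `eq` only moves units.
  paste (r° A) (send E A f (return g)) =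
    return ((f 𝔸.⊗₁ id I) ⨟ (eqToHom eq ⨟ (g 𝔸.⊗₁ id A))) ,
    ⌜⨟⌝ _ _
      ∙ ⊘-≋ (same (≈-sym (⌜⌝-⊗ f (id I))) ∙ ∣-≋ ≋-refl (same (⌜⌝-id I)))
          (⌜⨟⌝ _ _
            ∙ ⊘-≋ (⌜eqToHom⌝ eq ∙ idʰ-≋ (𝔸.⊗₀-identityʳ _) ∙ middle)
                  (same (≈-sym (⌜⌝-⊗ g (id A))) ∙ ∣-≋ ≋-refl (same (⌜⌝-id A)))
            ∙ ≋-sym (exchange (idʰ E ∣ s° A) ⌜ g ⌝ (r° A) (idʰ A)))
      ∙ ≋-sym (exchange ⌜ f ⌝ _ (idʰ I) (r° A ⊘ idʰ A))
      ∙ ∣-≋ ≋-refl (unitᵛˡ _ ∙ unitᵛʳ (r° A))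
    where
    eq : (E ⊗ A) ⊗ I ≡ (E ⊗ I) ⊗ A
    eq = trans (𝔸.⊗₀-identityʳ (E ⊗ A)) (cong (_⊗ A) (sym (𝔸.⊗₀-identityʳ E)))
    middle : idʰ (E ⊗ A) ≋ (idʰ E ∣ s° A) ∣ r° A
    middle = ≋-sym (same (idʰ-⊗ E A))
      ∙ ∣-≋ ≋-refl (≋-sym (transport _ _ _ ∙ same (yank°-∣ A)))
      ∙ ≋-sym (assocʰ (idʰ E) (s° A) (r° A))
  -- Likewise a single `recv` is forced, and the object it waits for comes from the top of `s• A`.
  paste (s• A) (recv E A f (return g)) =
    return ((f 𝔸.⊗₁ id A) ⨟ (eqToHom eq ⨟ (g 𝔸.⊗₁ id I))) ,
    ⌜⨟⌝ _ _
      ∙ ⊘-≋ (same (≈-sym (⌜⌝-⊗ f (id A))) ∙ ∣-≋ ≋-refl (same (⌜⌝-id A)))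
          (⌜⨟⌝ _ _
            ∙ ⊘-≋ (⌜eqToHom⌝ eq ∙ idʰ-≋ (cong (_⊗ A) (𝔸.⊗₀-identityʳ E)) ∙ middle)
                  (same (≈-sym (⌜⌝-⊗ g (id I))) ∙ ∣-≋ ≋-refl (same (⌜⌝-id I)))
            ∙ ≋-sym (exchange (idʰ E ∣ r• A) ⌜ g ⌝ (s• A) (idʰ I)))
      ∙ ≋-sym (exchange ⌜ f ⌝ _ (idʰ A) (s• A ⊘ idʰ I))
      ∙ ∣-≋ ≋-refl (unitᵛˡ _ ∙ unitᵛʳ (s• A))
    where
    eq : (E ⊗ I) ⊗ A ≡ (E ⊗ A) ⊗ I
    eq = trans (cong (_⊗ A) (𝔸.⊗₀-identityʳ E)) (sym (𝔸.⊗₀-identityʳ (E ⊗ A)))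
    middle : idʰ (E ⊗ A) ≋ (idʰ E ∣ r• A) ∣ s• A
    middle = ≋-sym (same (idʰ-⊗ E A))
      ∙ ∣-≋ ≋-refl (≋-sym (transport _ _ _ ∙ same (yank•-∣ A)))
      ∙ ≋-sym (assocʰ (idʰ E) (r• A) (s• A))
  paste ⌜ g ⌝ (return f) = return (f 𝔸.⊗₁ g) , same (≈-sym (⌜⌝-⊗ f g))
  paste (idʰ A) (return f) =
    return (f 𝔸.⊗₁ id A) , same (≈-sym (⌜⌝-⊗ f (id A))) ∙ ∣-≋ ≋-refl (same (⌜⌝-id A))
  paste (idᵛ X) n =
    castNF (sym (𝔸.⊗₀-identityʳ _)) (sym (𝔸.⊗₀-identityʳ _)) n ,
    ⟪castNF⟫ _ _ n ∙ ≋-sym (unitʰʳ ⟪ n ⟫)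
  paste (α ∣ β) n with paste α n
  ... | m , p with paste β m
  ... | k , q =
    castNF (𝔸.⊗₀-assoc _ _ _) (𝔸.⊗₀-assoc _ _ _) k ,
    ⟪castNF⟫ _ _ k ∙ q ∙ ∣-≋ p ≋-refl ∙ assocʰ ⟪ n ⟫ α β
  paste (_⊘_ {X = X} α β) n with split X n
  ... | _ , n₁ , n₂ , p with paste α n₁ | paste β n₂
  ... | m₁ , q₁ | m₂ , q₂ =
    join m₁ m₂ ,
    ⟪join⟫ m₁ m₂ ∙ ⊘-≋ q₁ q₂ ∙ ≋-sym (exchange ⟪ n₁ ⟫ ⟪ n₂ ⟫ α β) ∙ ∣-≋ p ≋-refl

  castHom : ∀ {A A′ B B′} → A ≡ A′ → B ≡ B′ → Hom A B → Hom A′ B′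
  castHom refl refl f = f

  ⌜castHom⌝ : ∀ {A A′ B B′} (p : A ≡ A′) (q : B ≡ B′) (f : Hom A B) → ⌜ castHom p q f ⌝ ≋ ⌜ f ⌝
  ⌜castHom⌝ refl refl f = ≋-refl

  -- Pasting to the right of the identity on `I` gives a normal form with empty right boundary,
  -- which can only be a `return`.
  ⌜⌝-surjective : ∀ {A B} (α : Cell A B [] []) → Σ[ f ∈ Hom A B ] ⌜ f ⌝ ≋ α
  ⌜⌝-surjective α with paste α (return (id I))
  ... | return f , p =
    castHom (𝔸.⊗₀-identityˡ _) (𝔸.⊗₀-identityˡ _) f ,
    ⌜castHom⌝ _ _ f ∙ p ∙ ∣-≋ (same (⌜⌝-id I)) ≋-refl ∙ idʰIˡ α

-- Copresheaves on 𝔸 and their transformations.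

module Model {o ℓ e} (𝔸 : SymmetricStrictMonoidalCategory o ℓ e) where
  open SymmetricStrictMonoidalCategory 𝔸 using (Obj; Hom; I; id; _⨟_; _⊗₁_)
    renaming (_⊗₀_ to _⊗_; _≈_ to _~_)
  private
    module 𝔸 = SymmetricStrictMonoidalCategory 𝔸
    module ~ {A B} = IsEquivalence (𝔸.≈-isEquivalence {A} {B})
  open FreeCornering 𝔸 hiding (_≈_)
  open FreeCornering 𝔸 using () renaming (_≈_ to _≈ᶜ_)

  L : Level
  L = o ⊔ ℓ ⊔ e

  -- Setoid-valued functors on 𝔸. The level `L` is large enough for `G₀`, whose elements are
  -- families over all objects, to stay within the same type.
  record Copresheaf : Set (lsuc L) where
    infix 4 _≈_
    field
      At       : Obj → Set L
      _≈_      : ∀ {C} → At C → At C → Set L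
      ≈-isEquivalence : ∀ {C} → IsEquivalence (_≈_ {C})
      act      : ∀ {C D} → Hom C D → At C → At D
      act-cong : ∀ {C D} {f g : Hom C D} {x y : At C} → f ~ g → x ≈ y → act f x ≈ act g y
      act-id   : ∀ {C} (x : At C) → act (id C) x ≈ x
      act-⨟    : ∀ {C D E} (f : Hom C D) (g : Hom D E) (x : At C) →
                 act (f ⨟ g) x ≈ act g (act f x)
    module ≈ {C} = IsEquivalence (≈-isEquivalence {C})

  open Copresheaf using (At; act)

  record _⇒_ (P Q : Copresheaf) : Set L where
    private
      module P = Copresheaf P
      module Q = Copresheaf Q
    field
      app         : ∀ {C} → At P C → At Q C
      app-cong    : ∀ {C} {x y : At P C} → x P.≈ y → app x Q.≈ app y
      app-natural : ∀ {C D} (k : Hom C D) (x : At P C) → act Q k (app x) Q.≈ app (act P k x)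

  open _⇒_ using (app; app-cong; app-natural)

  module On (Q : Copresheaf) where
    open Copresheaf Q using (_≈_)
    private module ≈ {C} = IsEquivalence (Copresheaf.≈-isEquivalence Q {C})

    infixr 5 _▸_
    _▸_ : ∀ {C} {x y z : At Q C} → x ≈ y → y ≈ z → x ≈ z
    _▸_ = ≈.trans

    done : ∀ {C} {x : At Q C} → x ≈ x
    done = ≈.refl

    flip : ∀ {C} {x y : At Q C} → x ≈ y → y ≈ x
    flip = ≈.sym

    eq : ∀ {C} {x y : At Q C} → x ≡ y → x ≈ y
    eq = ≈.reflexive

    eq≅ : ∀ {C} {x y : At Q C} → x ≅ y → x ≈ y
    eq≅ p = eq (≅-to-≡ p)

  infix 4 _≐_
  _≐_ : ∀ {P Q} → P ⇒ Q → P ⇒ Q → Set L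
  _≐_ {P} {Q} σ τ = ∀ {C} (x : At P C) → Copresheaf._≈_ Q (app σ x) (app τ x)

  idN : ∀ {P} → P ⇒ P
  idN {P} = record
    { app = λ x → x ; app-cong = λ p → p ; app-natural = λ k x → Copresheaf.≈.refl P }

  infixr 9 _∘_
  _∘_ : ∀ {P Q R} → Q ⇒ R → P ⇒ Q → P ⇒ R
  _∘_ {R = R} σ τ = record
    { app = λ x → app σ (app τ x)
    ; app-cong = λ p → app-cong σ (app-cong τ p)
    ; app-natural = λ k x →
        Copresheaf.≈.trans R (app-natural σ k (app τ x)) (app-cong σ (app-natural τ k x))
    }

  -- The action of an object by tensoring, and its right adjoint.

  R₀ : Obj → Copresheaf → Copresheaf
  R₀ A P = record
    { At = λ C → At P (C ⊗ A)
    ; _≈_ = P._≈_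
    ; ≈-isEquivalence = P.≈-isEquivalence
    ; act = λ k → act P (k ⊗₁ id A)
    ; act-cong = λ p q → P.act-cong (𝔸.⊗₁-cong p ~.refl) q
    ; act-id = λ x → P.≈.trans (P.act-cong (𝔸.⊗₁-id _ A) P.≈.refl) (P.act-id x)
    ; act-⨟ = λ f g x → P.≈.trans
        (P.act-cong (~.trans (𝔸.⊗₁-cong ~.refl (~.sym (𝔸.⨟-identityˡ (id A))))
                             (𝔸.⊗₁-⨟ f g (id A) (id A)))
          P.≈.refl)
        (P.act-⨟ _ _ x)
    }
    where module P = Copresheaf P

  R₁ : ∀ A {P Q} → P ⇒ Q → R₀ A P ⇒ R₀ A Q
  R₁ A σ = record
    { app = app σ ; app-cong = app-cong σ ; app-natural = λ k → app-natural σ (k ⊗₁ id A) }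

  -- Natural families from `Hom C (D ⊗ A)` to `At P D`, with `D` varying: the end formula for the
  -- right Kan extension of `P` along tensoring with `A`.
  record Fam (A : Obj) (P : Copresheaf) (C : Obj) : Set L where
    private module P = Copresheaf P
    field
      fam         : ∀ {D} → Hom C (D ⊗ A) → At P D
      fam-cong    : ∀ {D} {h h′ : Hom C (D ⊗ A)} → h ~ h′ → fam h P.≈ fam h′
      fam-natural : ∀ {D E} (k : Hom D E) (h : Hom C (D ⊗ A)) →
                    act P k (fam h) P.≈ fam (h ⨟ (k ⊗₁ id A))

  open Fam

  -- The right adjoint of R₀ A.
  G₀ : Obj → Copresheaf → Copresheaf
  G₀ A P = record
    { At = Fam A P
    ; _≈_ = λ φ ψ → ∀ {D} (h : Hom _ (D ⊗ A)) → fam φ h P.≈ fam ψ h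
    ; ≈-isEquivalence = record
      { refl = λ h → P.≈.refl
      ; sym = λ p h → P.≈.sym (p h)
      ; trans = λ p q h → P.≈.trans (p h) (q h)
      }
    ; act = λ k φ → record
      { fam = λ h → fam φ (k ⨟ h)
      ; fam-cong = λ p → fam-cong φ (𝔸.⨟-cong ~.refl p)
      ; fam-natural = λ k′ h → P.≈.trans (fam-natural φ k′ (k ⨟ h)) (fam-cong φ (𝔸.⨟-assoc k h _))
      }
    ; act-cong = λ {C} {D} {f} {g} {φ} {ψ} p q h →
        P.≈.trans (q (f ⨟ h)) (fam-cong ψ (𝔸.⨟-cong p ~.refl))
    ; act-id = λ φ h → fam-cong φ (𝔸.⨟-identityˡ h)
    ; act-⨟ = λ f g φ h → fam-cong φ (𝔸.⨟-assoc f g h)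
    }
    where module P = Copresheaf P

  G₁ : ∀ A {P Q} → P ⇒ Q → G₀ A P ⇒ G₀ A Q
  G₁ A {P} {Q} σ = record
    { app = λ φ → record
      { fam = λ h → app σ (fam φ h)
      ; fam-cong = λ p → app-cong σ (fam-cong φ p)
      ; fam-natural = λ k h → Q.≈.trans (app-natural σ k (fam φ h)) (app-cong σ (fam-natural φ k h))
      }
    ; app-cong = λ p h → app-cong σ (p h)
    ; app-natural = λ k φ h → Q.≈.refl
    }
    where module Q = Copresheaf Q

  unit : ∀ A P → P ⇒ G₀ A (R₀ A P)
  unit A P = record
    { app = λ x → record
      { fam = λ h → act P h x
      ; fam-cong = λ p → P.act-cong p P.≈.refl
      ; fam-natural = λ k h → P.≈.sym (P.act-⨟ h _ x)
      }
    ; app-cong = λ p h → P.act-cong ~.refl p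
    ; app-natural = λ k x h → P.act-⨟ k h x
    }
    where module P = Copresheaf P

  counit : ∀ A P → R₀ A (G₀ A P) ⇒ P
  counit A P = record
    { app = λ {C} φ → fam φ (id (C ⊗ A))
    ; app-cong = λ {C} p → p (id (C ⊗ A))
    ; app-natural = λ {C} {D} k φ → P.≈.trans (fam-natural φ k (id (C ⊗ A)))
        (fam-cong φ (~.trans (𝔸.⨟-identityˡ _) (~.sym (𝔸.⨟-identityʳ _))))
    }
    where module P = Copresheaf P

  -- Actions of vertical edges.

  T₀ : Exchange → Copresheaf → Copresheaf
  T₀ []            P = P
  T₀ ((A , ○) ∷ X) P = G₀ A (T₀ X P)
  T₀ ((A , ●) ∷ X) P = R₀ A (T₀ X P)

  T₁ : ∀ X {P Q} → P ⇒ Q → T₀ X P ⇒ T₀ X Q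
  T₁ []            σ = σ
  T₁ ((A , ○) ∷ X) σ = G₁ A (T₁ X σ)
  T₁ ((A , ●) ∷ X) σ = R₁ A (T₁ X σ)

  T-cong : ∀ X {P Q} {σ τ : P ⇒ Q} → σ ≐ τ → T₁ X σ ≐ T₁ X τ
  T-cong []            p     = p
  T-cong ((A , ○) ∷ X) {σ = σ} {τ} p φ h = T-cong X {σ = σ} {τ} p (fam φ h)
  T-cong ((A , ●) ∷ X) {σ = σ} {τ} p x   = T-cong X {σ = σ} {τ} p x

  T-id : ∀ X {P} → T₁ X (idN {P}) ≐ idN
  T-id []            {P} x = Copresheaf.≈.refl P
  T-id ((A , ○) ∷ X) φ h   = T-id X (fam φ h)
  T-id ((A , ●) ∷ X) x     = T-id X x

  T-∘ : ∀ X {P Q R} (σ : Q ⇒ R) (τ : P ⇒ Q) → T₁ X (σ ∘ τ) ≐ T₁ X σ ∘ T₁ X τ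
  T-∘ []            {R = R} σ τ x = Copresheaf.≈.refl R
  T-∘ ((A , ○) ∷ X) σ τ φ h       = T-∘ X σ τ (fam φ h)
  T-∘ ((A , ●) ∷ X) σ τ x         = T-∘ X σ τ x

  eqN : ∀ {P Q} → P ≡ Q → P ⇒ Q
  eqN refl = idN

  -- Such a map changes only the type of an element. The same holds for `a`, `ρ`, `R≡` and `T≡`, so
  -- composites of coherence maps evaluated at an element are compared by chaining `_≅_`.
  eqN-≅ : ∀ {P Q} (p : P ≡ Q) {C} (x : At P C) → app (eqN p) x ≅ x
  eqN-≅ refl x = _≅_.refl

  T-++ : ∀ X Y P → T₀ (X ++ Y) P ≡ T₀ X (T₀ Y P)
  T-++ []            Y P = refl
  T-++ ((A , ○) ∷ X) Y P = cong (G₀ A) (T-++ X Y P)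
  T-++ ((A , ●) ∷ X) Y P = cong (R₀ A) (T-++ X Y P)

  j : ∀ X Y P → T₀ (X ++ Y) P ⇒ T₀ X (T₀ Y P)
  j X Y P = eqN (T-++ X Y P)

  j⁻¹ : ∀ X Y P → T₀ X (T₀ Y P) ⇒ T₀ (X ++ Y) P
  j⁻¹ X Y P = eqN (sym (T-++ X Y P))

  eqN-G : ∀ A {P Q} (p : P ≡ Q) → eqN (cong (G₀ A) p) ≐ G₁ A (eqN p)
  eqN-G A {P} refl φ h = Copresheaf.≈.refl P

  eqN-R : ∀ A {P Q} (p : P ≡ Q) → eqN (cong (R₀ A) p) ≐ R₁ A (eqN p)
  eqN-R A {P} refl x = Copresheaf.≈.refl P

  eqN-T : ∀ X {P Q} (p : P ≡ Q) → eqN (cong (T₀ X) p) ≐ T₁ X (eqN p)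
  eqN-T X {P} refl x = On.flip (T₀ X P) (T-id X x)

  j-natural : ∀ X Y {P Q} (σ : P ⇒ Q) →
              j X Y Q ∘ T₁ (X ++ Y) σ ≐ T₁ X (T₁ Y σ) ∘ j X Y P
  j-natural [] Y {Q = Q} σ x = On.done (T₀ Y Q)
  j-natural ((A , ○) ∷ X) Y {P} {Q} σ φ h =
    eqN-G A (T-++ X Y Q) (app (T₁ ((A , ○) ∷ X ++ Y) σ) φ) h
      ▸ j-natural X Y σ (fam φ h)
      ▸ app-cong (T₁ X (T₁ Y σ)) (On.flip (T₀ X (T₀ Y P)) (eqN-G A (T-++ X Y P) φ h))
    where open On (T₀ X (T₀ Y Q))
  j-natural ((A , ●) ∷ X) Y {P} {Q} σ x =
    eqN-R A (T-++ X Y Q) (app (T₁ (X ++ Y) σ) x)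
      ▸ j-natural X Y σ x
      ▸ app-cong (T₁ X (T₁ Y σ)) (On.flip (T₀ X (T₀ Y P)) (eqN-R A (T-++ X Y P) x))
    where open On (T₀ X (T₀ Y Q))

  j-inverseˡ : ∀ X Y P {C} (x : At (T₀ (X ++ Y) P) C) → app (j⁻¹ X Y P) (app (j X Y P) x) ≡ x
  j-inverseˡ X Y P x with T₀ (X ++ Y) P | T-++ X Y P
  ... | _ | refl = refl

  j-inverseʳ : ∀ X Y P {C} (x : At (T₀ X (T₀ Y P)) C) → app (j X Y P) (app (j⁻¹ X Y P) x) ≡ x
  j-inverseʳ X Y P x with T₀ (X ++ Y) P | T-++ X Y P
  ... | _ | refl = refl

  j⁻¹-natural : ∀ X Y {P Q} (σ : P ⇒ Q) →
                j⁻¹ X Y Q ∘ T₁ X (T₁ Y σ) ≐ T₁ (X ++ Y) σ ∘ j⁻¹ X Y P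
  j⁻¹-natural X Y {P} {Q} σ x =
    app-cong (j⁻¹ X Y Q)
      (app-cong (T₁ X (T₁ Y σ)) (On.eq (T₀ X (T₀ Y P)) (sym (j-inverseʳ X Y P x)))
        ▸′ On.flip (T₀ X (T₀ Y Q)) (j-natural X Y σ (app (j⁻¹ X Y P) x)))
      ▸ eq (j-inverseˡ X Y Q _)
    where
    open On (T₀ (X ++ Y) Q)
    open On (T₀ X (T₀ Y Q)) using () renaming (_▸_ to _▸′_)

  T-square : ∀ X {P Q Q′ S} (σ : Q ⇒ S) (τ : P ⇒ Q) (σ′ : Q′ ⇒ S) (τ′ : P ⇒ Q′) →
             σ ∘ τ ≐ σ′ ∘ τ′ → T₁ X σ ∘ T₁ X τ ≐ T₁ X σ′ ∘ T₁ X τ′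
  T-square X {S = S} σ τ σ′ τ′ p x =
    flip (T-∘ X σ τ x) ▸ T-cong X {σ = σ ∘ τ} {σ′ ∘ τ′} p x ▸ T-∘ X σ′ τ′ x
    where open On (T₀ X S)

  T-inverse : ∀ X {P Q} (σ : Q ⇒ P) (τ : P ⇒ Q) → σ ∘ τ ≐ idN → T₁ X σ ∘ T₁ X τ ≐ idN
  T-inverse X {P} σ τ p x =
    flip (T-∘ X σ τ x) ▸ T-cong X {σ = σ ∘ τ} {idN} p x ▸ T-id X x
    where open On (T₀ X P)

  -- Coherence maps for the tensor product.

  module _ (P : Copresheaf) where
    open Copresheaf P using (_≈_)
    private module P = Copresheaf P

    coe : ∀ {C D} → C ≡ D → P.At C → P.At D
    coe = subst P.At

    coe-≅ : ∀ {C D} (p : C ≡ D) (x : P.At C) → coe p x ≅ x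
    coe-≅ p x = ≡-subst-removable P.At p x

    act-coe : ∀ {C C′ D D′} (p : C ≡ C′) (q : D ≡ D′) {k : Hom C D} {k′ : Hom C′ D′} →
              subst₂ Hom p q k ~ k′ → ∀ x → P.act k′ (coe p x) ≈ coe q (P.act k x)
    act-coe refl refl r x = P.act-cong (~.sym r) P.≈.refl

    act-coe⁻¹ : ∀ {C C′ D D′} (p : C ≡ C′) (q : D ≡ D′) {k : Hom C D} {k′ : Hom C′ D′} →
                subst₂ Hom p q k ~ k′ → ∀ x → P.act k (coe (sym p) x) ≈ coe (sym q) (P.act k′ x)
    act-coe⁻¹ refl refl r x = P.act-cong r P.≈.refl

    coe-cong : ∀ {C D} (p : C ≡ D) {x y : P.At C} → x ≈ y → coe p x ≈ coe p y
    coe-cong refl q = q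

  app-coe : ∀ {P Q} (σ : P ⇒ Q) {C D} (p : C ≡ D) (x : At P C) →
            app σ (coe P p x) ≡ coe Q p (app σ x)
  app-coe σ refl x = refl

  ⊗₁-assoc-id : ∀ {C D} (k : Hom C D) A B →
    subst₂ Hom (𝔸.⊗₀-assoc C A B) (𝔸.⊗₀-assoc D A B) ((k ⊗₁ id A) ⊗₁ id B) ~ k ⊗₁ id (A ⊗ B)
  ⊗₁-assoc-id k A B =
    ~.trans (𝔸.⊗₁-assoc k (id A) (id B)) (𝔸.⊗₁-cong ~.refl (𝔸.⊗₁-id A B))

  a : ∀ A B P → R₀ A (R₀ B P) ⇒ R₀ (A ⊗ B) P
  a A B P = record
    { app = λ {C} → coe P (𝔸.⊗₀-assoc C A B)
    ; app-cong = λ {C} → coe-cong P (𝔸.⊗₀-assoc C A B)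
    ; app-natural = λ {C} {D} k →
        act-coe P (𝔸.⊗₀-assoc C A B) (𝔸.⊗₀-assoc D A B) (⊗₁-assoc-id k A B)
    }

  a⁻¹ : ∀ A B P → R₀ (A ⊗ B) P ⇒ R₀ A (R₀ B P)
  a⁻¹ A B P = record
    { app = λ {C} → coe P (sym (𝔸.⊗₀-assoc C A B))
    ; app-cong = λ {C} → coe-cong P (sym (𝔸.⊗₀-assoc C A B))
    ; app-natural = λ {C} {D} k →
        act-coe⁻¹ P (𝔸.⊗₀-assoc C A B) (𝔸.⊗₀-assoc D A B) (⊗₁-assoc-id k A B)
    }

  ρ : ∀ P → R₀ I P ⇒ P
  ρ P = record
    { app = λ {C} → coe P (𝔸.⊗₀-identityʳ C)
    ; app-cong = λ {C} → coe-cong P (𝔸.⊗₀-identityʳ C)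
    ; app-natural = λ {C} {D} k →
        act-coe P (𝔸.⊗₀-identityʳ C) (𝔸.⊗₀-identityʳ D) (𝔸.⊗₁-identityʳ k)
    }

  ρ⁻¹ : ∀ P → P ⇒ R₀ I P
  ρ⁻¹ P = record
    { app = λ {C} → coe P (sym (𝔸.⊗₀-identityʳ C))
    ; app-cong = λ {C} → coe-cong P (sym (𝔸.⊗₀-identityʳ C))
    ; app-natural = λ {C} {D} k →
        act-coe⁻¹ P (𝔸.⊗₀-identityʳ C) (𝔸.⊗₀-identityʳ D) (𝔸.⊗₁-identityʳ k)
    }

  R≡ : ∀ {A B} P → A ≡ B → R₀ A P ⇒ R₀ B P
  R≡ P refl = idN

  a-≅ : ∀ A B P {C} (x : At P ((C ⊗ A) ⊗ B)) → app (a A B P) {C} x ≅ x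
  a-≅ A B P x = coe-≅ P _ x

  a⁻¹-≅ : ∀ A B P {C} (x : At P (C ⊗ (A ⊗ B))) → app (a⁻¹ A B P) {C} x ≅ x
  a⁻¹-≅ A B P x = coe-≅ P _ x

  ρ-≅ : ∀ P {C} (x : At P (C ⊗ I)) → app (ρ P) {C} x ≅ x
  ρ-≅ P x = coe-≅ P _ x

  ρ⁻¹-≅ : ∀ P {C} (x : At P C) → app (ρ⁻¹ P) {C} x ≅ x
  ρ⁻¹-≅ P x = coe-≅ P _ x

  R≡-≅ : ∀ {A B} P (p : A ≡ B) {C} (x : At P (C ⊗ A)) → app (R≡ P p) {C} x ≅ x
  R≡-≅ P refl x = _≅_.refl

  -- Interpretation of cells.

  actN : ∀ {A B} → Hom A B → ∀ P → R₀ A P ⇒ R₀ B P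
  actN {A} {B} f P = record
    { app = λ {C} → act P (id C ⊗₁ f)
    ; app-cong = P.act-cong ~.refl
    ; app-natural = λ {C} {D} k x → P.≈.trans (P.≈.sym (P.act-⨟ _ _ x)) (P.≈.trans
        (P.act-cong (~.trans (~.sym (𝔸.⊗₁-⨟ (id C) k f (id B)))
                    (~.trans (𝔸.⊗₁-cong (~.trans (𝔸.⨟-identityˡ k) (~.sym (𝔸.⨟-identityʳ k)))
                                        (~.trans (𝔸.⨟-identityʳ f) (~.sym (𝔸.⨟-identityˡ f))))
                             (𝔸.⊗₁-⨟ k (id D) (id A) f)))
                    P.≈.refl)
        (P.act-⨟ _ _ x))
    }
    where module P = Copresheaf P

  -- The ○ corners become, up to units, the counit and unit of the adjunction between `R₀ A` and
  -- `G₀ A`. The ● corners merely insert or delete a unit, because `A •` acts just as `A` does.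
  ⟦_⟧ : ∀ {A B X Y} → Cell A B X Y → ∀ P → R₀ A (T₀ Y P) ⇒ T₀ X (R₀ B P)
  ⟦ s° A ⟧  P = ρ⁻¹ P ∘ counit A P
  ⟦ r° A ⟧  P = unit A P ∘ ρ P
  ⟦ s• A ⟧  P = R₁ A (ρ⁻¹ P)
  ⟦ r• A ⟧  P = ρ (R₀ A P)
  ⟦ ⌜ f ⌝ ⟧ P = actN f P
  ⟦ idʰ A ⟧ P = idN
  ⟦ idᵛ X ⟧ P = T₁ X (ρ⁻¹ P) ∘ ρ (T₀ X P)
  ⟦ _∣_ {A} {B} {C} {D} {X} {Y} {Z} α β ⟧ P =
    T₁ X (a B D P) ∘ ⟦ α ⟧ (R₀ D P) ∘ R₁ A (⟦ β ⟧ P) ∘ a⁻¹ A C (T₀ Z P)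
  ⟦ _⊘_ {A} {B} {C} {X} {Y} {X′} {Y′} α β ⟧ P =
    j⁻¹ X X′ (R₀ C P) ∘ T₁ X (⟦ β ⟧ P) ∘ ⟦ α ⟧ (T₀ Y′ P) ∘ R₁ A (j Y Y′ P)

  -- Naturality in the copresheaf. In `sound` it carries coherence maps, and for interchange the
  -- whole interpretation of a cell, across `⟦ α ⟧`.
  ⟦⟧-natural : ∀ {A B X Y} (α : Cell A B X Y) {P Q} (σ : P ⇒ Q) →
               T₁ X (R₁ B σ) ∘ ⟦ α ⟧ P ≐ ⟦ α ⟧ Q ∘ R₁ A (T₁ Y σ)
  ⟦⟧-natural (s° A) {P} {Q} σ x = On.eq Q (app-coe σ _ _)
  ⟦⟧-natural (r° A) {P} {Q} σ x h =
    On._▸_ Q (On.flip Q (app-natural σ h _)) (Copresheaf.act-cong Q ~.refl (On.eq Q (app-coe σ _ x)))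
  ⟦⟧-natural (s• A) {P} {Q} σ x = On.eq Q (app-coe σ _ x)
  ⟦⟧-natural (r• A) {P} {Q} σ x = On.eq Q (app-coe (R₁ A σ) _ x)
  ⟦⟧-natural ⌜ f ⌝ {P} {Q} σ x = On.flip Q (app-natural σ _ x)
  ⟦⟧-natural (idʰ A) {P} {Q} σ x = On.done Q
  ⟦⟧-natural (idᵛ X) {P} {Q} σ x =
    T-square X (R₁ I σ) (ρ⁻¹ P) (ρ⁻¹ Q) σ (λ y → On.eq Q (app-coe σ _ y)) (app (ρ (T₀ X P)) x)
      ▸ app-cong (T₁ X (ρ⁻¹ Q)) (On.eq (T₀ X Q) (app-coe (T₁ X σ) _ x))
    where open On (T₀ X (R₀ I Q))
  ⟦⟧-natural (_∣_ {A} {B} {C} {D} {X} {Y} {Z} α β) {P} {Q} σ x =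
    T-square X (R₁ (B ⊗ D) σ) (a B D P) (a B D Q) (R₁ B (R₁ D σ))
        (λ y → On.eq Q (app-coe σ _ y)) _
      ▸ app-cong (T₁ X (a B D Q)) (⟦⟧-natural α (R₁ D σ) _)
      ▸ app-cong (T₁ X (a B D Q)) (app-cong (⟦ α ⟧ (R₀ D Q)) (⟦⟧-natural β σ _))
      ▸ app-cong (T₁ X (a B D Q)) (app-cong (⟦ α ⟧ (R₀ D Q)) (app-cong (⟦ β ⟧ Q)
          (On.eq (T₀ Z Q) (app-coe (T₁ Z σ) _ x))))
    where open On (T₀ X (R₀ (B ⊗ D) Q))
  ⟦⟧-natural (_⊘_ {A} {B} {C} {X} {Y} {X′} {Y′} α β) {P} {Q} σ x =
    flip (j⁻¹-natural X X′ (R₁ C σ) _)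
      ▸ app-cong (j⁻¹ X X′ (R₀ C Q))
          (T-square X (T₁ X′ (R₁ C σ)) (⟦ β ⟧ P) (⟦ β ⟧ Q) (R₁ B (T₁ Y′ σ)) (⟦⟧-natural β σ) _)
      ▸ app-cong (j⁻¹ X X′ (R₀ C Q)) (app-cong (T₁ X (⟦ β ⟧ Q)) (⟦⟧-natural α (T₁ Y′ σ) _))
      ▸ app-cong (j⁻¹ X X′ (R₀ C Q)) (app-cong (T₁ X (⟦ β ⟧ Q)) (app-cong (⟦ α ⟧ (T₀ Y′ Q))
          (On.flip (T₀ Y (T₀ Y′ Q)) (j-natural Y Y′ σ x))))
    where open On (T₀ (X ++ X′) (R₀ C Q))

  -- Soundness of the interpretation.

  T≡ : ∀ {X Y} P → X ≡ Y → T₀ X P ⇒ T₀ Y P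
  T≡ P refl = idN

  T≡-≅ : ∀ {X Y} P (p : X ≡ Y) {C} (x : At (T₀ X P) C) → app (T≡ P p) x ≅ x
  T≡-≅ P refl x = _≅_.refl

  ⟦⟧-substʰ : ∀ {A A′ B B′ X Y} (p : A ≡ A′) (q : B ≡ B′) (α : Cell A B X Y) P →
    ⟦ subst₂ (λ T U → Cell T U X Y) p q α ⟧ P
      ≐ T₁ X (R≡ P q) ∘ ⟦ α ⟧ P ∘ R≡ (T₀ Y P) (sym p)
  ⟦⟧-substʰ {B = B} {X = X} refl refl α P x = On.flip (T₀ X (R₀ B P)) (T-id X _)

  ⟦⟧-substᵛ : ∀ {A B X X′ Y Y′} (p : X ≡ X′) (q : Y ≡ Y′) (α : Cell A B X Y) P →
    ⟦ subst₂ (Cell A B) p q α ⟧ P ≐ T≡ (R₀ B P) p ∘ ⟦ α ⟧ P ∘ R₁ A (T≡ P (sym q))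
  ⟦⟧-substᵛ {B = B} {X = X} refl refl α P x = On.done (T₀ X (R₀ B P))

  -- Induction on the derivation. Associativity and unit laws reduce to naturality and comparisons
  -- of coherence maps, interchange to naturality, the ○ yanking equations to triangle identities,
  -- and the equations for `⌜_⌝` to functoriality of `P`.
  sound : ∀ {A B X Y} {α β : Cell A B X Y} → α ≈ᶜ β → ∀ P → ⟦ α ⟧ P ≐ ⟦ β ⟧ P
  sound {B = B} {X} ≈-refl P x = On.done (T₀ X (R₀ B P))
  sound {B = B} {X} (≈-sym p) P x = On.flip (T₀ X (R₀ B P)) (sound p P x)
  sound {B = B} {X} (≈-trans p q) P x = On._▸_ (T₀ X (R₀ B P)) (sound p P x) (sound q P x)
  sound (∣-cong {A} {B} {C} {D} {X} {Y} {Z} {α} {α′} {β} {β′} p q) P x =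
    app-cong (T₁ X (a B D P)) (sound p (R₀ D P) _
      ▸ app-cong (⟦ α′ ⟧ (R₀ D P)) (sound q P _))
    where open On (T₀ X (R₀ B (R₀ D P)))
  sound (⊘-cong {A} {B} {C} {X} {Y} {X′} {Y′} {α} {α′} {β} {β′} p q) P x =
    app-cong (j⁻¹ X X′ (R₀ C P))
      (T-cong X {σ = ⟦ β ⟧ P} {⟦ β′ ⟧ P} (sound q P) _
        ▸ app-cong (T₁ X (⟦ β′ ⟧ P)) (sound p (T₀ Y′ P) _))
    where open On (T₀ X (T₀ X′ (R₀ C P)))
  sound (∣-assoc {A} {B} {C} {D} {E} {F} {X} {Y} {Z} {W} α β γ) P x =
    ⟦⟧-substʰ p q ((α ∣ β) ∣ γ) P x
      ▸ app-cong (T₁ X (R≡ P q)) (app-cong (T₁ X (a (B ⊗ D) F P)) (app-cong (T₁ X (a B D (R₀ F P)))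
          (app-cong (⟦ α ⟧ (R₀ D (R₀ F P))) (app-cong (⟦ β ⟧ (R₀ F P)) (
            On.flip (T₀ Z (R₀ F P)) (On.eq (T₀ Z (R₀ F P)) (app-coe (⟦ γ ⟧ P) _ _))
            ▸₁ app-cong (⟦ γ ⟧ P) (On.eq≅ (T₀ W P)
                (≅.trans (a⁻¹-≅ A C (R₀ E (T₀ W P)) _)
                (≅.trans (a⁻¹-≅ (A ⊗ C) E (T₀ W P) _)
                (≅.trans (R≡-≅ (T₀ W P) (sym p) x)
                (≅.sym (≅.trans (a⁻¹-≅ C E (T₀ W P) _)
                                (a⁻¹-≅ A (C ⊗ E) (T₀ W P) x)))))))
            )))))
      ▸ flip (T-∘ X (R≡ P q) (a (B ⊗ D) F P) _)
      ▸ T-square X (R≡ P q ∘ a (B ⊗ D) F P) (a B D (R₀ F P)) (a B (D ⊗ F) P) (R₁ B (a D F P))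
          (λ y → On.eq≅ P
            (≅.trans (R≡-≅ P q _) (≅.trans (a-≅ (B ⊗ D) F P _) (≅.trans (a-≅ B D (R₀ F P) y)
            (≅.sym (≅.trans (a-≅ B (D ⊗ F) P _) (a-≅ D F P y))))))) _
      ▸ app-cong (T₁ X (a B (D ⊗ F) P)) (⟦⟧-natural α (a D F P) _)
    where
    open On (T₀ X (R₀ (B ⊗ (D ⊗ F)) P))
    open On (T₀ Z (R₀ F P)) using () renaming (_▸_ to _▸₁_)
    p = 𝔸.⊗₀-assoc A C E
    q = 𝔸.⊗₀-assoc B D F
  sound (∣-identityˡ {A} {B} {X} {Y} α) P x =
    ⟦⟧-substʰ p q (idᵛ X ∣ α) P x
      ▸ app-cong (T₁ X (R≡ P q)) (app-cong (T₁ X (a I B P)) (app-cong (T₁ X (ρ⁻¹ (R₀ B P)))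
          (On.flip (T₀ X (R₀ B P)) (On.eq (T₀ X (R₀ B P)) (app-coe (⟦ α ⟧ P) _ _))
            ▸ app-cong (⟦ α ⟧ P) (On.eq≅ (T₀ Y P)
                (≅.trans (ρ-≅ (R₀ A (T₀ Y P)) _)
                (≅.trans (a⁻¹-≅ I A (T₀ Y P) _) (R≡-≅ (T₀ Y P) (sym p) x)))))))
      ▸ flip (T-∘ X (R≡ P q) (a I B P) _)
      ▸ T-inverse X (R≡ P q ∘ a I B P) (ρ⁻¹ (R₀ B P))
          (λ y → On.eq≅ P (≅.trans (R≡-≅ P q _) (≅.trans (a-≅ I B P _) (ρ⁻¹-≅ (R₀ B P) y)))) _
    where
    open On (T₀ X (R₀ B P))
    p = 𝔸.⊗₀-identityˡ A
    q = 𝔸.⊗₀-identityˡ B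
  sound (∣-identityʳ {A} {B} {X} {Y} α) P x =
    ⟦⟧-substʰ p q (α ∣ idᵛ Y) P x
      ▸ app-cong (T₁ X (R≡ P q)) (app-cong (T₁ X (a B I P))
          (On.flip (T₀ X (R₀ B (R₀ I P))) (⟦⟧-natural α (ρ⁻¹ P) _)))
      ▸ flip (T-∘ X (R≡ P q) (a B I P) _)
      ▸ T-inverse X (R≡ P q ∘ a B I P) (R₁ B (ρ⁻¹ P))
          (λ y → On.eq≅ P (≅.trans (R≡-≅ P q _) (≅.trans (a-≅ B I P _) (ρ⁻¹-≅ P y)))) _
      ▸ app-cong (⟦ α ⟧ P) (On.eq≅ (T₀ Y P)
          (≅.trans (ρ-≅ (T₀ Y P) _) (≅.trans (a⁻¹-≅ A I (T₀ Y P) _) (R≡-≅ (T₀ Y P) (sym p) x))))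
    where
    open On (T₀ X (R₀ B P))
    p = 𝔸.⊗₀-identityʳ A
    q = 𝔸.⊗₀-identityʳ B
  sound (⊘-assoc {A} {B} {C} {D} {X} {Y} {X′} {Y′} {X″} {Y″} α β γ) P x =
    ⟦⟧-substᵛ p q ((α ⊘ β) ⊘ γ) P x
      ▸ app-cong (T≡ Q p) (app-cong (j⁻¹ (X ++ X′) X″ Q)
          (On.flip (T₀ (X ++ X′) (T₀ X″ Q)) (j⁻¹-natural X X′ (⟦ γ ⟧ P) _)))
      ▸ eq≅ (≅.trans (T≡-≅ Q p _)
            (≅.trans (eqN-≅ (sym (T-++ (X ++ X′) X″ Q)) _)
            (≅.trans (eqN-≅ (sym (T-++ X X′ (T₀ X″ Q))) _)
            (≅.sym (≅.trans (eqN-≅ (sym (T-++ X (X′ ++ X″) Q)) _)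
                            (eqN-≅ (cong (T₀ X) (sym (T-++ X′ X″ Q))) _))))))
      ▸ app-cong (j⁻¹ X (X′ ++ X″) Q)
          (eqN-T X (sym (T-++ X′ X″ Q)) _
            ▸₁ app-cong (T₁ X (j⁻¹ X′ X″ Q)) (app-cong (T₁ X (T₁ X′ (⟦ γ ⟧ P)))
                 (app-cong (T₁ X (⟦ β ⟧ (T₀ Y″ P)))
                   (app-cong (⟦ α ⟧ (T₀ Y′ (T₀ Y″ P))) inner
                     ▸₂ On.flip (T₀ X (R₀ B (T₀ Y′ (T₀ Y″ P)))) (⟦⟧-natural α (j Y′ Y″ P) _))
                   ▸₃ On.flip S₃ (T-∘ X (⟦ β ⟧ (T₀ Y″ P)) (R₁ B (j Y′ Y″ P)) _))
                 ▸₄ On.flip S₄ (T-∘ X (T₁ X′ (⟦ γ ⟧ P)) (⟦ β ⟧ (T₀ Y″ P) ∘ R₁ B (j Y′ Y″ P)) _))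
            ▸₁ On.flip (T₀ X (T₀ (X′ ++ X″) Q))
                 (T-∘ X (j⁻¹ X′ X″ Q) (T₁ X′ (⟦ γ ⟧ P) ∘ ⟦ β ⟧ (T₀ Y″ P) ∘ R₁ B (j Y′ Y″ P)) _))
    where
    p = ++-assoc X X′ X″
    q = ++-assoc Y Y′ Y″
    Q = R₀ D P
    S₃ = T₀ X (T₀ X′ (R₀ C (T₀ Y″ P)))
    S₄ = T₀ X (T₀ X′ (T₀ X″ Q))
    open On (T₀ (X ++ (X′ ++ X″)) Q)
    open On (T₀ X (T₀ (X′ ++ X″) Q)) using () renaming (_▸_ to _▸₁_)
    open On (T₀ X (R₀ B (T₀ Y′ (T₀ Y″ P)))) using () renaming (_▸_ to _▸₂_)
    open On S₃ using () renaming (_▸_ to _▸₃_)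
    open On S₄ using () renaming (_▸_ to _▸₄_)
    inner : ∀ {C} {y : At (T₀ (Y ++ (Y′ ++ Y″)) P) C} → Copresheaf._≈_ (T₀ Y (T₀ Y′ (T₀ Y″ P)))
              (app (j Y Y′ (T₀ Y″ P)) (app (j (Y ++ Y′) Y″ P) (app (T≡ P (sym q)) y)))
              (app (T₁ Y (j Y′ Y″ P)) (app (j Y (Y′ ++ Y″) P) y))
    inner {y = y} = On._▸_ (T₀ Y (T₀ Y′ (T₀ Y″ P)))
      (On.eq≅ (T₀ Y (T₀ Y′ (T₀ Y″ P)))
        (≅.trans (eqN-≅ (T-++ Y Y′ (T₀ Y″ P)) _)
        (≅.trans (eqN-≅ (T-++ (Y ++ Y′) Y″ P) _)
        (≅.trans (T≡-≅ P (sym q) y)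
        (≅.sym (≅.trans (eqN-≅ (cong (T₀ Y) (T-++ Y′ Y″ P)) _)
                        (eqN-≅ (T-++ Y (Y′ ++ Y″) P) y)))))))
      (eqN-T Y (T-++ Y′ Y″ P) _)
  sound (⊘-identityˡ {A} {B} {X} {Y} α) P x =
    ⟦⟧-substᵛ p q (idʰ A ⊘ α) P x
      ▸ eq≅ (T≡-≅ (R₀ B P) p _)
      ▸ app-cong (⟦ α ⟧ P) (On.eq≅ (T₀ Y P) (T≡-≅ P (sym q) x))
    where
    open On (T₀ X (R₀ B P))
    p = ++-identityˡ X
    q = ++-identityˡ Y
  sound (⊘-identityʳ {A} {B} {X} {Y} α) P x =
    ⟦⟧-substᵛ p q (α ⊘ idʰ B) P x
      ▸ eq≅ (≅.trans (T≡-≅ (R₀ B P) p _) (eqN-≅ (sym (T-++ X [] (R₀ B P))) _))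
      ▸ T-id X _
      ▸ app-cong (⟦ α ⟧ P) (On.eq≅ (T₀ Y P)
          (≅.trans (eqN-≅ (T-++ Y [] P) _) (T≡-≅ P (sym q) x)))
    where
    open On (T₀ X (R₀ B P))
    p = ++-identityʳ X
    q = ++-identityʳ Y
  sound (idʰ-⊗ A B) P x = On.eq≅ P (≅.trans (a-≅ A B P _) (a⁻¹-≅ A B P x))
  sound (idᵛ-⊗ X Y) P x =
    app-cong (j⁻¹ X Y (R₀ I P))
      (T-∘ X (T₁ Y (ρ⁻¹ P)) (ρ (T₀ Y P)) _
        ▸₁ app-cong (T₁ X (T₁ Y (ρ⁻¹ P))) (T-inverse X (ρ (T₀ Y P)) (ρ⁻¹ (T₀ Y P))
             (λ y → On.eq≅ (T₀ Y P) (≅.trans (ρ-≅ (T₀ Y P) _) (ρ⁻¹-≅ (T₀ Y P) y))) _))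
      ▸ j⁻¹-natural X Y (ρ⁻¹ P) _
      ▸ app-cong (T₁ (X ++ Y) (ρ⁻¹ P)) (On.eq≅ (T₀ (X ++ Y) P)
          (≅.trans (eqN-≅ (sym (T-++ X Y P)) _)
          (≅.trans (ρ-≅ (T₀ X (T₀ Y P)) _)
          (≅.trans (eqN-≅ (T-++ X Y P) x)
          (≅.sym (ρ-≅ (T₀ (X ++ Y) P) x))))))
    where
    open On (T₀ (X ++ Y) (R₀ I P))
    open On (T₀ X (T₀ Y (R₀ I P))) using () renaming (_▸_ to _▸₁_)
  sound idʰ-I P x = On.eq≅ P (≅.sym (≅.trans (ρ⁻¹-≅ P _) (ρ-≅ P x)))
  sound (interchange {A} {B} {C} {D} {E} {F} {X} {Y} {Z} {X′} {Y′} {Z′} α β γ δ) P x =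
    flip (j⁻¹-natural X X′ (a C F P) _)
      ▸ app-cong (j⁻¹ X X′ Q)
          (app-cong (T₁ X (T₁ X′ (a C F P)))
            (app-cong (T₁ X (⟦ β ⟧ (R₀ F P)))
              (app-cong (⟦ α ⟧ (T₀ Y′ (R₀ F P)))
                (On.eq (T₀ Y (T₀ Y′ (R₀ F P))) (j-inverseʳ Y Y′ (R₀ F P) _)
                  ▸₁ app-cong (T₁ Y (⟦ δ ⟧ P)) (app-cong (⟦ γ ⟧ (T₀ Z′ P))
                       (On.eq (T₀ Z (T₀ Z′ P)) (app-coe (j Z Z′ P) _ x))))
                -- The left-hand side applies `γ`, `δ`, `α`, `β` in this order, the right-hand side
                -- `γ`, `α`, `δ`, `β`; this is the exchange of `δ` and `α`.
                ▸₂ On.flip (T₀ X (R₀ B (T₀ Y′ (R₀ F P)))) (⟦⟧-natural α (⟦ δ ⟧ P) _)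
                -- A cancelling pair `a`, `a⁻¹` is inserted, since the right-hand side rebrackets
                -- between its two rows.
                ▸₂ app-cong (T₁ X (R₁ B (⟦ δ ⟧ P))) (On.flip (T₀ X (R₀ B (R₀ E (T₀ Z′ P))))
                     (T-inverse X (a⁻¹ B E (T₀ Z′ P)) (a B E (T₀ Z′ P))
                       (λ y → On.eq≅ (T₀ Z′ P)
                         (≅.trans (a⁻¹-≅ B E (T₀ Z′ P) _) (a-≅ B E (T₀ Z′ P) y))) _))
                ▸₂ On.flip (T₀ X (R₀ B (T₀ Y′ (R₀ F P))))
                     (T-∘ X (R₁ B (⟦ δ ⟧ P)) (a⁻¹ B E (T₀ Z′ P)) _))
              ▸₃ On.flip S₃ (T-∘ X (⟦ β ⟧ (R₀ F P)) (R₁ B (⟦ δ ⟧ P) ∘ a⁻¹ B E (T₀ Z′ P)) _))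
            ▸₄ On.flip S₄ (T-∘ X (T₁ X′ (a C F P))
                 (⟦ β ⟧ (R₀ F P) ∘ R₁ B (⟦ δ ⟧ P) ∘ a⁻¹ B E (T₀ Z′ P)) _))
    where
    Q = R₀ (C ⊗ F) P
    S₃ = T₀ X (T₀ X′ (R₀ C (R₀ F P)))
    S₄ = T₀ X (T₀ X′ Q)
    open On (T₀ (X ++ X′) Q)
    open On (T₀ Y (T₀ Y′ (R₀ F P))) using () renaming (_▸_ to _▸₁_)
    open On (T₀ X (R₀ B (T₀ Y′ (R₀ F P)))) using () renaming (_▸_ to _▸₂_)
    open On S₃ using () renaming (_▸_ to _▸₃_)
    open On S₄ using () renaming (_▸_ to _▸₄_)
  -- First triangle identity: the counit evaluates the family given by the unit at an identity,
  -- which acts trivially.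
  sound (yank°-∣ A) P x =
    ⟦⟧-substʰ p q (s° A ∣ r° A) P x
      ▸ app-cong (R≡ P q) (app-cong (a I A P) (app-cong (ρ⁻¹ (R₀ A P)) (Copresheaf.act-id P _)))
      ▸ eq≅ (≅.trans (R≡-≅ P q _) (≅.trans (a-≅ I A P _) (≅.trans (ρ⁻¹-≅ (R₀ A P) _)
            (≅.trans (ρ-≅ P _) (≅.trans (a⁻¹-≅ A I P _) (R≡-≅ P (sym p) x))))))
    where
    open On P
    p = 𝔸.⊗₀-identityʳ A
    q = 𝔸.⊗₀-identityˡ A
  -- Second triangle identity, which comes down to the right unit law for `h`.
  sound (yank°-⊘ A) P x h =
    app-cong (ρ⁻¹ P) (fam-cong (app (ρ (G₀ A P)) x) (𝔸.⨟-identityʳ h))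
  sound (yank•-∣ A) P x =
    ⟦⟧-substʰ p q (r• A ∣ s• A) P x
      ▸ eq≅ (≅.trans (R≡-≅ P q _) (≅.trans (a-≅ A I P _) (≅.trans (ρ-≅ (R₀ A (R₀ I P)) _)
            (≅.trans (ρ⁻¹-≅ P _) (≅.trans (a⁻¹-≅ I A P _) (R≡-≅ P (sym p) x))))))
    where
    open On P
    p = 𝔸.⊗₀-identityˡ A
    q = 𝔸.⊗₀-identityʳ A
  sound (yank•-⊘ A) P x = On.done P
  sound (⌜⌝-cong p) P x = Copresheaf.act-cong P (𝔸.⊗₁-cong ~.refl p) (On.done P)
  sound (⌜⌝-⨟ f g) P {C} x =
    flip (Copresheaf.act-⨟ P _ _ x)
      ▸ Copresheaf.act-cong P
          (~.trans (~.sym (𝔸.⊗₁-⨟ (id C) (id C) f g)) (𝔸.⊗₁-cong (𝔸.⨟-identityˡ (id C)) ~.refl))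
          done
    where open On P
  sound (⌜⌝-id A) P {C} x =
    Copresheaf.act-cong P (𝔸.⊗₁-id C A) done ▸ Copresheaf.act-id P x
    where open On P
  sound (⌜⌝-⊗ {A} {B} {C} {D} f g) P {E} x =
    coe-cong P (𝔸.⊗₀-assoc E B D)
        (flip (Copresheaf.act-⨟ P _ _ _)
          ▸ Copresheaf.act-cong P
              (~.trans (~.sym (𝔸.⊗₁-⨟ (id (E ⊗ A)) (id E ⊗₁ f) g (id D)))
                       (𝔸.⊗₁-cong (𝔸.⨟-identityˡ _) (𝔸.⨟-identityʳ g)))
              done)
      ▸ flip (act-coe P (𝔸.⊗₀-assoc E A C) (𝔸.⊗₀-assoc E B D) (𝔸.⊗₁-assoc (id E) f g) _)
      ▸ Copresheaf.act-cong P ~.refl (eq≅ (≅.trans (a-≅ A C P _) (a⁻¹-≅ A C P x)))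
    where open On P

  -- Corepresentable copresheaves and injectivity of `⌜_⌝`.

  corepresentable : Obj → Copresheaf
  corepresentable A = record
    { At = λ C → Lift L (Hom A C)
    ; _≈_ = λ x y → Lift L (lower x ~ lower y)
    ; ≈-isEquivalence = record
      { refl = lift ~.refl
      ; sym = λ p → lift (~.sym (lower p))
      ; trans = λ p q → lift (~.trans (lower p) (lower q))
      }
    ; act = λ k x → lift (lower x ⨟ k)
    ; act-cong = λ p q → lift (𝔸.⨟-cong (lower q) p)
    ; act-id = λ x → lift (𝔸.⨟-identityʳ (lower x))
    ; act-⨟ = λ f g x → lift (~.sym (𝔸.⨟-assoc (lower x) f g))
    }

  subst₂-Hom-cong : ∀ {A A′ B B′} (p : A ≡ A′) (q : B ≡ B′) {f g : Hom A B} →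
                    f ~ g → subst₂ Hom p q f ~ subst₂ Hom p q g
  subst₂-Hom-cong refl refl r = r

  -- A Yoneda argument: equal cells act equally on the identity of `I ⊗ A`, taken in component `I`,
  -- and there `⌜ f ⌝` yields `id I ⊗₁ f`, from which the unit law recovers `f`.
  ⌜⌝-injective : ∀ {A B} {f g : Hom A B} → ⌜ f ⌝ ≈ᶜ ⌜ g ⌝ → f ~ g
  ⌜⌝-injective {A} {B} {f} {g} p =
    ~.trans (~.sym (𝔸.⊗₁-identityˡ f))
      (~.trans (subst₂-Hom-cong (𝔸.⊗₀-identityˡ A) (𝔸.⊗₀-identityˡ B)
        (~.trans (~.sym (𝔸.⨟-identityˡ _))
          (~.trans (lower (sound p (corepresentable (I ⊗ A)) {I} (lift (id (I ⊗ A)))))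
            (𝔸.⨟-identityˡ _))))
        (𝔸.⊗₁-identityˡ g))

-- Isomorphisms in a strict monoidal category, and equality of morphisms up to boundaries.

module Isos {o ℓ e} (𝕄 : StrictMonoidalCategory o ℓ e) where
  open StrictMonoidalCategory 𝕄
  open Iso
  module ≈ {A B} = IsEquivalence (≈-isEquivalence {A} {B})

  cancel-inner : ∀ {A B C D} {f : Hom A B} {g : Hom B C} {g′ : Hom C B} {f′ : Hom B D} →
                 g ⨟ g′ ≈ id B → (f ⨟ g) ⨟ (g′ ⨟ f′) ≈ f ⨟ f′
  cancel-inner {f = f} {g} {g′} {f′} p =
    ≈.trans (⨟-assoc f g (g′ ⨟ f′)) (⨟-cong ≈.refl
      (≈.trans (≈.sym (⨟-assoc g g′ f′)) (≈.trans (⨟-cong p ≈.refl) (⨟-identityˡ f′))))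

  infixr 7 _⨟ⁱ_
  _⨟ⁱ_ : ∀ {A B C} → Iso A B → Iso B C → Iso A C
  i ⨟ⁱ k = record
    { to = to i ⨟ to k
    ; from = from k ⨟ from i
    ; to-from = ≈.trans (cancel-inner (to-from k)) (to-from i)
    ; from-to = ≈.trans (cancel-inner (from-to i)) (from-to k)
    }

  infixr 8 _⊗ⁱ_
  _⊗ⁱ_ : ∀ {A B C D} → Iso A B → Iso C D → Iso (A ⊗₀ C) (B ⊗₀ D)
  i ⊗ⁱ k = record
    { to = to i ⊗₁ to k
    ; from = from i ⊗₁ from k
    ; to-from = ≈.trans (≈.sym (⊗₁-⨟ _ _ _ _))
        (≈.trans (⊗₁-cong (to-from i) (to-from k)) (⊗₁-id _ _))
    ; from-to = ≈.trans (≈.sym (⊗₁-⨟ _ _ _ _))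
        (≈.trans (⊗₁-cong (from-to i) (from-to k)) (⊗₁-id _ _))
    }

  idⁱ : ∀ A → Iso A A
  idⁱ A = record
    { to = id A ; from = id A ; to-from = ⨟-identityˡ (id A) ; from-to = ⨟-identityˡ (id A) }

  eqⁱ : ∀ {A B} → A ≡ B → Iso A B
  eqⁱ p = record { to = eqToHom p ; from = eqToHom (sym p) ; to-from = inv p ; from-to = inv′ p }
    where
    inv : ∀ {A B} (p : A ≡ B) → eqToHom p ⨟ eqToHom (sym p) ≈ id A
    inv refl = ⨟-identityˡ (id _)
    inv′ : ∀ {A B} (p : A ≡ B) → eqToHom (sym p) ⨟ eqToHom p ≈ id B
    inv′ refl = ⨟-identityˡ (id _)

  from-unique : ∀ {A B} (i k : Iso A B) → to i ≈ to k → from i ≈ from k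
  from-unique i k p =
    ≈.trans (≈.sym (⨟-identityʳ (from i)))
      (≈.trans (⨟-cong ≈.refl (≈.sym (≈.trans (⨟-cong p ≈.refl) (to-from k))))
        (≈.trans (≈.sym (⨟-assoc (from i) (to i) (from k)))
          (≈.trans (⨟-cong (from-to i) ≈.refl) (⨟-identityˡ (from k)))))

  idempotent-iso : ∀ {A} (i : Iso A A) → to i ⨟ to i ≈ to i → to i ≈ id A
  idempotent-iso i p =
    ≈.trans (≈.sym (⨟-identityʳ (to i)))
      (≈.trans (⨟-cong ≈.refl (≈.sym (to-from i)))
        (≈.trans (≈.sym (⨟-assoc (to i) (to i) (from i)))
          (≈.trans (⨟-cong p ≈.refl) (to-from i))))

  infix 4 _≋_
  data _≋_ {A B} (f : Hom A B) : ∀ {A′ B′} → Hom A′ B′ → Set (o ⊔ ℓ ⊔ e) where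
    same : ∀ {g : Hom A B} → f ≈ g → f ≋ g

  from≋ : ∀ {A B} {f g : Hom A B} → f ≋ g → f ≈ g
  from≋ (same p) = p

  ≋-refl : ∀ {A B} {f : Hom A B} → f ≋ f
  ≋-refl = same ≈.refl

  ≋-sym : ∀ {A B A′ B′} {f : Hom A B} {g : Hom A′ B′} → f ≋ g → g ≋ f
  ≋-sym (same p) = same (≈.sym p)

  infixr 5 _∙_
  _∙_ : ∀ {A B A′ B′ A″ B″} {f : Hom A B} {g : Hom A′ B′} {h : Hom A″ B″} →
        f ≋ g → g ≋ h → f ≋ h
  same p ∙ same q = same (≈.trans p q)

  ⨟-≋ : ∀ {A B C A′ B′ C′} {f : Hom A B} {g : Hom B C} {f′ : Hom A′ B′} {g′ : Hom B′ C′} →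
        f ≋ f′ → g ≋ g′ → f ⨟ g ≋ f′ ⨟ g′
  ⨟-≋ (same p) (same q) = same (⨟-cong p q)

  eqToHom-⨟ : ∀ {A B C} (p : A ≡ B) (f : Hom B C) → eqToHom p ⨟ f ≋ f
  eqToHom-⨟ refl f = same (⨟-identityˡ f)

  ⨟-eqToHom : ∀ {A B C} (f : Hom A B) (p : B ≡ C) → f ⨟ eqToHom p ≋ f
  ⨟-eqToHom f refl = same (⨟-identityʳ f)

  subst₂-≋ : ∀ {A A′ B B′} (p : A ≡ A′) (q : B ≡ B′) (f : Hom A B) → f ≋ subst₂ Hom p q f
  subst₂-≋ refl refl f = ≋-refl

-- Consequences of the hexagon for the symmetry.

module Braiding {o ℓ e} (𝔸 : SymmetricStrictMonoidalCategory o ℓ e) where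
  open SymmetricStrictMonoidalCategory 𝔸
  open Isos strictMonoidal public
  open Iso

  σⁱ : ∀ A B → Iso (A ⊗₀ B) (B ⊗₀ A)
  σⁱ A B = record
    { to = σ A B ; from = σ B A ; to-from = σ-involutive A B ; from-to = σ-involutive B A }

  private
    σ-unitⁱ : ∀ A → Iso A A
    σ-unitⁱ A = eqⁱ (sym (⊗₀-identityʳ A)) ⨟ⁱ (σⁱ A I ⨟ⁱ eqⁱ (⊗₀-identityˡ A))

    to-σ-unitⁱ : ∀ A → to (σ-unitⁱ A) ≋ σ A I
    to-σ-unitⁱ A =
      eqToHom-⨟ (sym (⊗₀-identityʳ A)) _ ∙ ⨟-eqToHom (σ A I) (⊗₀-identityˡ A)

    from-σ-unitⁱ : ∀ A → from (σ-unitⁱ A) ≋ σ I A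
    from-σ-unitⁱ A =
      ⨟-eqToHom _ (sym (sym (⊗₀-identityʳ A))) ∙ eqToHom-⨟ (sym (⊗₀-identityˡ A)) (σ I A)

    -- The hexagon at A, I, I says that σ A I is idempotent.
    σ-unitⁱ-id : ∀ A → to (σ-unitⁱ A) ≈ id A
    σ-unitⁱ-id A = idempotent-iso (σ-unitⁱ A) (from≋
      (⨟-≋ (to-σ-unitⁱ A ∙ same (≈.sym (⊗₁-identityʳ (σ A I))) ∙ ≋-sym (subst₂-≋ _ _ _))
           (to-σ-unitⁱ A ∙ same (≈.sym (⊗₁-identityˡ (σ A I))) ∙ ≋-sym (subst₂-≋ _ _ _)
             ∙ ≋-sym (eqToHom-⨟ (⊗₀-assoc I A I) (id I ⊗₁ σ A I)))
        ∙ same (≈.sym (σ-hexagon A I I))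
        ∙ eqToHom-⨟ (⊗₀-assoc A I I) _
        ∙ ⨟-eqToHom (σ A (I ⊗₀ I)) (⊗₀-assoc I I A)
        ∙ σ-≋ (⊗₀-identityˡ I)
        ∙ ≋-sym (to-σ-unitⁱ A)))
      where
      σ-≋ : ∀ {B C} → B ≡ C → σ A B ≋ σ A C
      σ-≋ refl = ≋-refl

  σ-unitʳ : ∀ A → σ A I ≋ id A
  σ-unitʳ A = ≋-sym (to-σ-unitⁱ A) ∙ same (σ-unitⁱ-id A)

  σ-unitˡ : ∀ A → σ I A ≋ id A
  σ-unitˡ A = ≋-sym (from-σ-unitⁱ A) ∙ same (from-unique (σ-unitⁱ A) (idⁱ A) (σ-unitⁱ-id A))

  private
    -- Both sides of the hexagon at `A`, `C`, `B` underlie isomorphisms, and equal isomorphisms have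
    -- equal inverses.
    σ-hexagon⁻¹ : ∀ A B C →
      σ (C ⊗₀ B) A ⨟ eqToHom (sym (⊗₀-assoc A C B))
        ≋ (id C ⊗₁ σ B A) ⨟ eqToHom (sym (⊗₀-assoc C A B)) ⨟ (σ C A ⊗₁ id B)
    σ-hexagon⁻¹ A B C =
      ≋-sym (⨟-≋ (eqToHom-⨟ (sym (⊗₀-assoc C B A)) (σ (C ⊗₀ B) A)) ≋-refl)
        ∙ same (from-unique
            (eqⁱ (⊗₀-assoc A C B) ⨟ⁱ (σⁱ A (C ⊗₀ B) ⨟ⁱ eqⁱ (⊗₀-assoc C B A)))
            ((σⁱ A C ⊗ⁱ idⁱ B) ⨟ⁱ (eqⁱ (⊗₀-assoc C A B) ⨟ⁱ (idⁱ C ⊗ⁱ σⁱ A B)))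
            (σ-hexagon A C B))
        ∙ same (⨟-assoc _ _ _)

  -- Both sides reverse the three factors `C`, `B`, `A`, a form of the Yang-Baxter equation. The
  -- hexagon expands the left-hand side, its inverse refolds the first three maps, and naturality
  -- moves `σ C B` to the front.
  σ-reverse : ∀ A B C →
    (id C ⊗₁ σ B A) ⨟ σ C (A ⊗₀ B) ≋ (σ C B ⊗₁ id A) ⨟ σ (B ⊗₀ C) A
  σ-reverse A B C =
    ⨟-≋ ≋-refl
        (≋-sym (⨟-eqToHom (σ C (A ⊗₀ B)) (⊗₀-assoc A B C))
          ∙ ≋-sym (eqToHom-⨟ (⊗₀-assoc C A B) _)
          ∙ same (σ-hexagon C A B)
          ∙ ≋-sym (eqToHom-⨟ (sym (⊗₀-assoc C A B)) _))
      ∙ same (≈.trans (⨟-cong ≈.refl (≈.sym (⨟-assoc _ _ _))) (≈.sym (⨟-assoc _ _ _)))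
      ∙ ⨟-≋ (≋-sym (σ-hexagon⁻¹ A B C)) ≋-refl
      ∙ same (≈.trans (cancel-inner (from-to (eqⁱ (⊗₀-assoc A C B))))
                      (≈.sym (σ-natural (σ C B) (id A))))


module _ {o ℓ e} (𝔸 : SymmetricStrictMonoidalCategory o ℓ e) where
  private module 𝔸 = SymmetricStrictMonoidalCategory 𝔸
  open 𝔸 using (Hom; I; σ; strictMonoidal) renaming (_⊗₀_ to _⊗_)
  open FreeCornering 𝔸
  open NormalForms 𝔸 using (⌜⌝-surjective; ⌜⨟⌝)
  open Model 𝔸 using (⌜⌝-injective)
  open Braiding 𝔸 using (σ-unitˡ; σ-unitʳ; σ-reverse; ⨟-eqToHom)
    renaming (_≋_ to _≋ᴬ_; same to sameᴬ; ≋-refl to ≋ᴬ-refl; _∙_ to _∙ᴬ_; ⨟-≋ to ⨟ᴬ-≋)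
  open Pasting 𝒞

  -- The functor given by the ○ corners.

  module Outgoing where
    corners : CornerStructure 𝒞
    corners = record
      { F = _° ; s = s° ; r = r°
      ; yank-∣ = λ A → transport _ _ _ ∙ same (yank°-∣ A)
      ; yank-⊘ = λ A → same (yank°-⊘ A)
      }

    module ° = Corners 𝒞 corners
    open ° using (ν; ν⁻¹; ε; map)

    map°≋ : ∀ {A B} (f : Hom A B) → map° f ≋ map ⌜ f ⌝
    map°≋ f = ≋-sym (°.map-≋ ⌜ f ⌝)

    map°-cong : ∀ {A B} {f g : Hom A B} → f 𝔸.≈ g → map° f ≈ map° g
    map°-cong p = ⊘-cong ≈-refl (⊘-cong (⌜⌝-cong p) ≈-refl)

    map°-cong-≋ : ∀ {A B A′ B′} {f : Hom A B} {g : Hom A′ B′} → f ≋ᴬ g → map° f ≋ map° g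
    map°-cong-≋ (sameᴬ p) = same (map°-cong p)

    map°-id : ∀ A → map° (𝔸.id A) ≋ idᵛ (A °)
    map°-id A = map°≋ _ ∙ °.map-cong (same (⌜⌝-id A)) ∙ °.map-id A

    map°-⨟ : ∀ {A B C} (f : Hom A B) (g : Hom B C) → map° (f 𝔸.⨟ g) ≋ map° f ⨟ map° g
    map°-⨟ f g = map°≋ (f 𝔸.⨟ g)
      ∙ ≋-sym (°.map-⨟ ⌜ f ⌝ ⌜ g ⌝ (≋-sym (⌜⨟⌝ f g)))
      ∙ ⨟-cong-≋ (≋-sym (map°≋ f)) (≋-sym (map°≋ g))

    ν-natural : ∀ {A B C D} (f : Hom A B) (g : Hom C D) →
                (map° f ⊘ map° g) ⨟ ν B D ≋ ν A C ⨟ map° (g 𝔸.⊗₁ f)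
    ν-natural f g =
      ⨟-cong-≋ (⊘-≋ (map°≋ f) (map°≋ g)) ≋-refl
        ∙ °.ν-natural ⌜ f ⌝ ⌜ g ⌝ (same (⌜⌝-⊗ g f))
        ∙ ⨟-cong-≋ ≋-refl (≋-sym (map°≋ (g 𝔸.⊗₁ f)))

    -- Collects all images of morphisms behind one `ν`, so that each coherence law for `μ` splits
    -- into a law for `ν` and an equation in 𝔸.
    ⊘-⨟-ν : ∀ {X Y A B C D E} (p : HCell X (A °)) (f : Hom A B) (q : HCell Y (C °)) (g : Hom C D)
            (h : Hom (D ⊗ B) E) →
            ((p ⨟ map° f) ⊘ (q ⨟ map° g)) ⨟ (ν B D ⨟ map° h)
              ≋ ((p ⊘ q) ⨟ ν A C) ⨟ map° ((g 𝔸.⊗₁ f) 𝔸.⨟ h)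
    ⊘-⨟-ν p f q g h =
      ⨟-cong-≋ (same (⊗-⨟ p (map° f) q (map° g))) ≋-refl
        ∙ same (⨟-assoc _ _ _)
        ∙ ⨟-cong-≋ ≋-refl
            (≋-sym (same (⨟-assoc _ _ _)) ∙ ⨟-cong-≋ (ν-natural f g) ≋-refl
              ∙ same (⨟-assoc _ _ _) ∙ ⨟-cong-≋ ≋-refl (≋-sym (map°-⨟ _ h)))
        ∙ ≋-sym (same (⨟-assoc _ _ _))

    ⨟-map°-id : ∀ {X A} (p : HCell X (A °)) → p ≋ p ⨟ map° (𝔸.id A)
    ⨟-map°-id {A = A} p =
      ≋-sym (same (⨟-identityʳ p)) ∙ ⨟-cong-≋ ≋-refl (≋-sym (map°-id A))

    id⨟-map° : ∀ {A B} (f : Hom A B) → map° f ≋ idᵛ (A °) ⨟ map° f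
    id⨟-map° f = ≋-sym (same (⨟-identityˡ (map° f)))

    id⊗id-⨟ : ∀ {A B C} (f : Hom (A ⊗ B) C) → (𝔸.id A 𝔸.⊗₁ 𝔸.id B) 𝔸.⨟ f ≋ᴬ f
    id⊗id-⨟ {A} {B} f = sameᴬ (~.trans (𝔸.⨟-cong (𝔸.⊗₁-id A B) ~.refl) (𝔸.⨟-identityˡ f))
      where module ~ {A B} = IsEquivalence (𝔸.≈-isEquivalence {A} {B})

    open Isos (𝐇 𝒞) using (_⨟ⁱ_)
    module 𝐇 = StrictMonoidalCategory (𝐇 𝒞)

    νⁱ : ∀ A B → 𝐇.Iso (A ° ++ B °) ((B ⊗ A) °)
    νⁱ A B = record
      { to = ν A B ; from = ν⁻¹ A B
      ; to-from = from≋ (°.ν-inverseˡ A B) ; from-to = from≋ (°.ν-inverseʳ A B) }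

    map°-σⁱ : ∀ A B → 𝐇.Iso ((A ⊗ B) °) ((B ⊗ A) °)
    map°-σⁱ A B = record
      { to = map° (σ A B) ; from = map° (σ B A)
      ; to-from = from≋ (inverse A B) ; from-to = from≋ (inverse B A) }
      where
      inverse : ∀ A B → map° (σ A B) ⨟ map° (σ B A) ≋ idᵛ ((A ⊗ B) °)
      inverse A B = ≋-sym (map°-⨟ _ _) ∙ same (map°-cong (𝔸.σ-involutive A B)) ∙ map°-id _

    -- The crossing σ is needed because ν reverses the order of the factors.
    μ : ∀ A B → HCell (A ° ++ B °) ((A ⊗ B) °)
    μ A B = ν A B ⨟ map° (σ B A)

    μ-⨟ : ∀ A B {C} (f : Hom (A ⊗ B) C) → μ A B ⨟ map° f ≋ ν A B ⨟ map° (σ B A 𝔸.⨟ f)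
    μ-⨟ A B f = same (⨟-assoc _ _ _) ∙ ⨟-cong-≋ ≋-refl (≋-sym (map°-⨟ (σ B A) f))

    μ-natural : ∀ {A B C D} (f : Hom A B) (g : Hom C D) →
                (map° f ⊘ map° g) ⨟ μ B D ≋ μ A C ⨟ map° (f 𝔸.⊗₁ g)
    μ-natural {A} {B} {C} {D} f g =
      ⨟-cong-≋ (⊘-≋ (id⨟-map° f) (id⨟-map° g)) ≋-refl
        ∙ ⊘-⨟-ν (idᵛ (A °)) f (idᵛ (C °)) g (σ D B)
        ∙ ⨟-cong-≋ (⨟-cong-≋ (same (idᵛ-⊗ (A °) (C °))) ≋-refl ∙ same (⨟-identityˡ (ν A C)))
                   (same (map°-cong (𝔸.σ-natural g f)))
        ∙ ≋-sym (μ-⨟ A C (f 𝔸.⊗₁ g))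

    -- The corners are settled by `ν-associative`; the crossings that remain behind them agree by
    -- `σ-reverse`.
    μ-associative : ∀ A B C →
      (μ A B ⊘ idᵛ (C °)) ⨟ (μ (A ⊗ B) C ⨟ map° (𝔸.associator A B C))
        ≋ (idᵛ (A °) ⊘ μ B C) ⨟ μ A (B ⊗ C)
    μ-associative A B C =
      ⨟-cong-≋ (⊘-≋ ≋-refl (⨟-map°-id (idᵛ (C °)))) (μ-⨟ (A ⊗ B) C (𝔸.associator A B C))
        ∙ ⊘-⨟-ν (ν A B) (σ B A) (idᵛ (C °)) (𝔸.id C) (σ C (A ⊗ B) 𝔸.⨟ 𝔸.associator A B C)
        ∙ ⨟-cong-≋ (°.ν-associative A B C)
            (map°-cong-≋ (⨟ᴬ-≋ ≋ᴬ-refl (⨟-eqToHom (σ C (A ⊗ B)) (𝔸.⊗₀-assoc A B C))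
              ∙ᴬ σ-reverse A B C))
        ∙ ≋-sym (⊘-⨟-ν (idᵛ (A °)) (𝔸.id A) (ν B C) (σ C B) (σ (B ⊗ C) A))
        ∙ ⨟-cong-≋ (⊘-≋ (≋-sym (⨟-map°-id (idᵛ (A °)))) ≋-refl) ≋-refl

    μ-unitalˡ : ∀ A → (ε ⊘ idᵛ (A °)) ⨟ (μ I A ⨟ map° (𝔸.unitorˡ A)) ≋ idᵛ (A °)
    μ-unitalˡ A =
      ⨟-cong-≋ (⊘-≋ (⨟-map°-id ε) (⨟-map°-id (idᵛ (A °)))) (μ-⨟ I A (𝔸.unitorˡ A))
        ∙ ⊘-⨟-ν ε (𝔸.id I) (idᵛ (A °)) (𝔸.id A) (σ A I 𝔸.⨟ 𝔸.unitorˡ A)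
        ∙ ⨟-cong-≋ (°.ν-unitalˡ A)
            (map°-cong-≋ (id⊗id-⨟ _ ∙ᴬ ⨟-eqToHom (σ A I) (𝔸.⊗₀-identityˡ A) ∙ᴬ σ-unitʳ A)
              ∙ map°-id A)
        ∙ same (⨟-identityˡ (idᵛ (A °)))

    μ-unitalʳ : ∀ A → (idᵛ (A °) ⊘ ε) ⨟ (μ A I ⨟ map° (𝔸.unitorʳ A)) ≋ idᵛ (A °)
    μ-unitalʳ A =
      ⨟-cong-≋ (⊘-≋ (⨟-map°-id (idᵛ (A °))) (⨟-map°-id ε)) (μ-⨟ A I (𝔸.unitorʳ A))
        ∙ ⊘-⨟-ν (idᵛ (A °)) (𝔸.id A) ε (𝔸.id I) (σ I A 𝔸.⨟ 𝔸.unitorʳ A)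
        ∙ ⨟-cong-≋ (°.ν-unitalʳ A)
            (map°-cong-≋ (id⊗id-⨟ _ ∙ᴬ ⨟-eqToHom (σ I A) (𝔸.⊗₀-identityʳ A) ∙ᴬ σ-unitˡ A)
              ∙ map°-id A)
        ∙ same (⨟-identityˡ (idᵛ (A °)))

    isStrongMonoidal : IsStrongMonoidalFunctor strictMonoidal (𝐇 𝒞) _° map°
    isStrongMonoidal = record
      { F-cong = map°-cong
      ; F-id = λ A → from≋ (map°-id A)
      ; F-⨟ = λ f g → from≋ (map°-⨟ f g)
      ; ε-iso = record
        { to = ε ; from = °.ε⁻¹
        ; to-from = from≋ °.ε-inverseˡ ; from-to = from≋ °.ε-inverseʳ }
      ; μ-iso = λ A B → νⁱ A B ⨟ⁱ map°-σⁱ B A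
      ; μ-natural = λ f g → from≋ (μ-natural f g)
      ; μ-associative = λ A B C → from≋ (μ-associative A B C ∙ ≋-sym (same (⨟-identityˡ _)))
      ; μ-unitalˡ = λ A → from≋ (μ-unitalˡ A)
      ; μ-unitalʳ = λ A → from≋ (μ-unitalʳ A)
      }

    -- Straightening `h` gives a cell with trivial sides, which is some `⌜ f ⌝`; that `f` is the
    -- preimage.
    full : Full strictMonoidal (𝐇 𝒞) _° map°
    full h with ⌜⌝-surjective (°.unmap h)
    ... | f , p = f , from≋ (map°≋ f ∙ °.map-cong p ∙ °.map-unmap h)

    faithful : Faithful strictMonoidal (𝐇 𝒞) _° map°
    faithful {x = f} {g} p =
      ⌜⌝-injective (from≋ (°.map-injective (≋-sym (map°≋ f) ∙ same p ∙ map°≋ g)))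

  -- The functor given by the ● corners.

  module Incoming where
    open Reflection 𝒞
    -- Seen upside down, `r•` has the shape of a sending corner and `s•` that of a receiving one,
    -- and the yanking equations keep their form.
    corners : CornerStructure reflected
    corners = record
      { F = _• ; s = r• ; r = s•
      ; yank-∣ = λ A → unreflect (transport _ _ _ ∙ same (yank•-∣ A))
      ; yank-⊘ = λ A → unreflect (same (yank•-⊘ A))
      }

    module • = Corners reflected corners
    open • using (ε; map)

    map•≋ : ∀ {A B} (f : Hom A B) → map• f ≋ map ⌜ f ⌝
    map•≋ {A} {B} f = ≋-sym (reflect (•.map-≋ ⌜ f ⌝) ∙ assocᵛ (r• A) ⌜ f ⌝ (s• B))

    map•-cong : ∀ {A B} {f g : Hom A B} → f 𝔸.≈ g → map• f ≈ map• g
    map•-cong p = ⊘-cong ≈-refl (⊘-cong (⌜⌝-cong p) ≈-refl)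

    map-cong : ∀ {A B A′ B′} {u : Cell A B [] []} {w : Cell A′ B′ [] []} → u ≋ w → map u ≋ map w
    map-cong p = reflect (•.map-cong (unreflect p))

    map•-id : ∀ A → map• (𝔸.id A) ≋ idᵛ (A •)
    map•-id A = map•≋ _ ∙ map-cong (same (⌜⌝-id A)) ∙ reflect (•.map-id A)

    -- Reflection reverses the vertical order of `⌜ f ⌝` and `⌜ g ⌝`; hence the contravariance.
    map•-⨟ : ∀ {A B C} (f : Hom A B) (g : Hom B C) → map• (f 𝔸.⨟ g) ≋ map• g ⨟ map• f
    map•-⨟ f g = map•≋ (f 𝔸.⨟ g)
      ∙ ≋-sym (reflect-⨟ _ _ ∙ reflect (•.map-⨟ ⌜ g ⌝ ⌜ f ⌝ (unreflect (≋-sym (⌜⨟⌝ f g)))))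
      ∙ ⨟-cong-≋ (≋-sym (map•≋ g)) (≋-sym (map•≋ f))

    module 𝐇 = StrictMonoidalCategory (𝐇 𝒞)

    -- The reflection has already reversed the vertical edges, so `ν` with its arguments swapped
    -- preserves the order of the factors.
    μ : ∀ A B → HCell (A • ++ B •) ((A ⊗ B) •)
    μ A B = •.ν B A

    μⁱ : ∀ A B → 𝐇.Iso (A • ++ B •) ((A ⊗ B) •)
    μⁱ A B = record
      { to = μ A B ; from = •.ν⁻¹ B A
      ; to-from = from≋ (reflect-⨟ _ _ ∙ reflect (•.ν-inverseˡ B A))
      ; from-to = from≋ (reflect-⨟ _ _ ∙ reflect (•.ν-inverseʳ B A)) }

    μ-natural : ∀ {A B C D} (f : Hom B A) (g : Hom D C) →
                (map• f ⊘ map• g) ⨟ μ B D ≋ μ A C ⨟ map• (f 𝔸.⊗₁ g)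
    μ-natural f g =
      ⨟-cong-≋ (⊘-≋ (map•≋ f) (map•≋ g)) ≋-refl
        ∙ reflect-⨟ _ _
        ∙ reflect (•.ν-natural ⌜ g ⌝ ⌜ f ⌝ (unreflect (same (⌜⌝-⊗ f g))))
        ∙ ≋-sym (reflect-⨟ _ _)
        ∙ ⨟-cong-≋ ≋-refl (≋-sym (map•≋ (f 𝔸.⊗₁ g)))

    module 𝔸ᵒᵖ = StrictMonoidalCategory (op strictMonoidal)

    ⨟-map•-eqToHom : ∀ {X A B} (k : HCell X (A •)) (p : A ≡ B) →
                     k ⨟ map• (𝔸ᵒᵖ.eqToHom p) ≋ k
    ⨟-map•-eqToHom k refl = ⨟-cong-≋ ≋-refl (map•-id _) ∙ same (⨟-identityʳ k)

    μ-associative : ∀ A B C →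
      (μ A B ⊘ idᵛ (C •)) ⨟ (μ (A ⊗ B) C ⨟ map• (𝔸ᵒᵖ.associator A B C))
        ≋ (idᵛ (A •) ⊘ μ B C) ⨟ μ A (B ⊗ C)
    μ-associative A B C =
      ⨟-cong-≋ ≋-refl (⨟-map•-eqToHom (μ (A ⊗ B) C) (𝔸.⊗₀-assoc A B C))
        ∙ reflect-⨟ _ _
        ∙ ≋-sym (reflect (•.ν-associative C B A))
        ∙ ≋-sym (reflect-⨟ _ _)

    μ-unitalˡ : ∀ A → (ε ⊘ idᵛ (A •)) ⨟ (μ I A ⨟ map• (𝔸ᵒᵖ.unitorˡ A)) ≋ idᵛ (A •)
    μ-unitalˡ A =
      -- Left and right unit laws trade places, as the tensor product of vertical edges is reversed
      -- by the reflection.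
      ⨟-cong-≋ ≋-refl (⨟-map•-eqToHom (μ I A) (𝔸.⊗₀-identityˡ A)) ∙ reflect-⨟ _ _ ∙ reflect (•.ν-unitalʳ A)

    μ-unitalʳ : ∀ A → (idᵛ (A •) ⊘ ε) ⨟ (μ A I ⨟ map• (𝔸ᵒᵖ.unitorʳ A)) ≋ idᵛ (A •)
    μ-unitalʳ A =
      ⨟-cong-≋ ≋-refl (⨟-map•-eqToHom (μ A I) (𝔸.⊗₀-identityʳ A)) ∙ reflect-⨟ _ _ ∙ reflect (•.ν-unitalˡ A)

    isStrongMonoidal : IsStrongMonoidalFunctor (op strictMonoidal) (𝐇 𝒞) _• map•
    isStrongMonoidal = record
      { F-cong = map•-cong
      ; F-id = λ A → from≋ (map•-id A)
      ; F-⨟ = λ f g → from≋ (map•-⨟ g f)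
      ; ε-iso = record
        { to = ε ; from = •.ε⁻¹
        ; to-from = from≋ (reflect-⨟ _ _ ∙ reflect •.ε-inverseˡ)
        ; from-to = from≋ (reflect-⨟ _ _ ∙ reflect •.ε-inverseʳ) }
      ; μ-iso = μⁱ
      ; μ-natural = λ f g → from≋ (μ-natural f g)
      ; μ-associative = λ A B C → from≋ (μ-associative A B C ∙ ≋-sym (same (⨟-identityˡ _)))
      ; μ-unitalˡ = λ A → from≋ (μ-unitalˡ A)
      ; μ-unitalʳ = λ A → from≋ (μ-unitalʳ A)
      }

    full : Full (op strictMonoidal) (𝐇 𝒞) _• map•
    full h with ⌜⌝-surjective (•.unmap h)
    ... | f , p = f , from≋ (map•≋ f ∙ map-cong p ∙ reflect (•.map-unmap h))

    faithful : Faithful (op strictMonoidal) (𝐇 𝒞) _• map•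
    faithful {x = f} {g} p = ⌜⌝-injective (from≋ (reflect (•.map-injective
      (unreflect (≋-sym (map•≋ f) ∙ same p ∙ map•≋ g)))))

lemma6p5 : ∀ {o ℓ e} (𝔸 : SymmetricStrictMonoidalCategory o ℓ e) →
    let open SymmetricStrictMonoidalCategory 𝔸 using (strictMonoidal)
        open FreeCornering 𝔸
        𝐇𝒞 = 𝐇 𝒞
        𝔸ᵒᵖ = op strictMonoidal
    in ( IsStrongMonoidalFunctor strictMonoidal 𝐇𝒞 _° map°
       × Full strictMonoidal 𝐇𝒞 _° map°
       × Faithful strictMonoidal 𝐇𝒞 _° map° )
     × ( IsStrongMonoidalFunctor 𝔸ᵒᵖ 𝐇𝒞 _• map•
       × Full 𝔸ᵒᵖ 𝐇𝒞 _• map•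
       × Faithful 𝔸ᵒᵖ 𝐇𝒞 _• map• )
lemma6p5 𝔸 =
  (Outgoing.isStrongMonoidal 𝔸 , Outgoing.full 𝔸 , Outgoing.faithful 𝔸) ,
  (Incoming.isStrongMonoidal 𝔸 , Incoming.full 𝔸 , Incoming.faithful 𝔸)
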